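{- For each integer $q\geq 4$, there exist a real constant $c>1$ and infinitely many $K_q$-divisible graphs $G$ with minimum degree $\delta(G)\geq \left(1-\frac{1}{c\cdot (q+1)}\right)v(G)$ such that $G$ has no $K_q$-decomposition and even no fractional $K_q$-decomposition.
   Context: Graphs are finite, simple and undirected, and "infinitely many" is understood up to isomorphism. For a graph $G$, $v(G)$ and $e(G)$ denote its numbers of vertices and edges, $d_G(x)$ the degree of a vertex $x$, and $\delta(G)$ the minimum degree. A graph $G$ is $K_q$-divisible if $\binom{q}{2}$ divides $e(G)$ and $q-1$ divides $d_G(x)$ for every vertex $x\in V(G)$. A $K_q$-decomposition of $G$ is a partition of the edge set of $G$ into (edge sets of) edge-disjoint copies of $K_q$ in $G$. A fractional $K_q$-decomposition of $G$ is an assignment of non-negative real weights to the copies of $K_q$ in $G$ such that for every edge $e$ of $G$, the total weight of the copies of $K_q$ containing $e$ is exactly $1$. -}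

module Defs where

open import Data.Bool.Base using (Bool; false; T)
open import Data.Bool.Properties using (T?)
open import Data.Fin.Base as Fin using (Fin)
import Data.Fin.Properties as Fin
open import Data.Fin.Subset using (Subset; _∈_; ∣_∣; inside; outside)
open import Data.Fin.Subset.Properties using (_∈?_)
open import Data.Integer.Base using (+_)
open import Data.List.Base as List
  using (List; []; _∷_; _++_; allFin; cartesianProduct; filter; foldr; length; lookup)
open import Data.List.Relation.Unary.All using (All)
open import Data.Nat.Base as ℕ using (ℕ; zero; suc; _∸_)
open import Data.Nat.Combinatorics using (_C_)
open import Data.Nat.Divisibility using (_∣_)
import Data.Nat.Properties as ℕ
open import Data.Product using (Σ; ∃; ∃!; _×_; _,_)
open import Data.Rational.Base as ℚ using (ℚ; 0ℚ; 1ℚ; ½; 1/_)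
import Data.Rational.Properties as ℚ
open import Data.Rational.Solver using (module +-*-Solver)
open import Data.Vec.Base using ([]; _∷_; tabulate)
open import Function.Bundles using (_↔_; Inverse)
open import Relation.Binary.PropositionalEquality
  using (_≡_; _≢_; refl; cong)
open import Relation.Nullary using (Dec; ¬_)
open import Relation.Nullary.Decidable using (_×-dec_; _→-dec_; ¬?)
open import Relation.Unary using (Pred)
open import Level using (0ℓ)

-- Real numbers: Cauchy sequences of rationals with |x m - x n| ≤ 2⁻ᵐ + 2⁻ⁿ
-- (so x n is within 2⁻ⁿ of the real it represents), compared by _≈ᴿ_. The
-- slack 2 · 2⁻ⁿ in the order relations accounts for both approximations.

2^- : ℕ → ℚ
2^- zero    = 1ℚ
2^- (suc n) = ½ ℚ.* 2^- n

record ℝ : Set where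
  field
    approx  : ℕ → ℚ
    -- One-sided, but quantified over both m and n, hence a bound on the
    -- absolute value of the difference.
    regular : ∀ m n → approx m ℚ.≤ approx n ℚ.+ (2^- m ℚ.+ 2^- n)

open ℝ public

infix  4 _≤ᴿ_ _≥ᴿ_ _<ᴿ_ _>ᴿ_ _≈ᴿ_
infixl 6 _+ᴿ_ _-ᴿ_
infixr 7 _·_

_≤ᴿ_ : ℝ → ℝ → Set
x ≤ᴿ y = ∀ n → approx x n ℚ.≤ approx y n ℚ.+ (2^- n ℚ.+ 2^- n)

_<ᴿ_ : ℝ → ℝ → Set
x <ᴿ y = ∃ λ n → approx x n ℚ.+ (2^- n ℚ.+ 2^- n) ℚ.< approx y n

_≥ᴿ_ : ℝ → ℝ → Set
x ≥ᴿ y = y ≤ᴿ x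

_>ᴿ_ : ℝ → ℝ → Set
x >ᴿ y = y <ᴿ x

_≈ᴿ_ : ℝ → ℝ → Set
x ≈ᴿ y = x ≤ᴿ y × y ≤ᴿ x

2^-≥0 : ∀ n → 0ℚ ℚ.≤ 2^- n
2^-≥0 zero    = ℚ.nonNegative⁻¹ 1ℚ
2^-≥0 (suc n) = begin
  0ℚ            ≡⟨ ℚ.*-zeroʳ ½ ⟨
  ½ ℚ.* 0ℚ      ≤⟨ ℚ.*-monoˡ-≤-nonNeg ½ (2^-≥0 n) ⟩
  ½ ℚ.* 2^- n   ∎
  where open ℚ.≤-Reasoning

2^-sum≥0 : ∀ m n → 0ℚ ℚ.≤ 2^- m ℚ.+ 2^- n
2^-sum≥0 m n = ℚ.+-mono-≤ (2^-≥0 m) (2^-≥0 n)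

p≤p+2^-sum : ∀ p m n → p ℚ.≤ p ℚ.+ (2^- m ℚ.+ 2^- n)
p≤p+2^-sum p m n = begin
  p                           ≡⟨ ℚ.+-identityʳ p ⟨
  p ℚ.+ 0ℚ                    ≤⟨ ℚ.+-monoʳ-≤ p (2^-sum≥0 m n) ⟩
  p ℚ.+ (2^- m ℚ.+ 2^- n)     ∎
  where open ℚ.≤-Reasoning

fromℚ : ℚ → ℝ
fromℚ p = record { approx = λ _ → p ; regular = p≤p+2^-sum p }

fromℕ : ℕ → ℝ
fromℕ n = fromℚ (+ n ℚ./ 1)

0ᴿ 1ᴿ : ℝ
0ᴿ = fromℕ 0
1ᴿ = fromℕ 1

_+ᴿ_ : ℝ → ℝ → ℝ
x +ᴿ y = record
  { approx  = λ n → approx x (suc n) ℚ.+ approx y (suc n)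
  ; regular = λ m n → begin
      approx x (suc m) ℚ.+ approx y (suc m)
        ≤⟨ ℚ.+-mono-≤ (regular x (suc m) (suc n)) (regular y (suc m) (suc n)) ⟩
      (approx x (suc n) ℚ.+ (½ ℚ.* 2^- m ℚ.+ ½ ℚ.* 2^- n))
        ℚ.+ (approx y (suc n) ℚ.+ (½ ℚ.* 2^- m ℚ.+ ½ ℚ.* 2^- n))
        ≡⟨ lemma (approx x (suc n)) (approx y (suc n)) (2^- m) (2^- n) ⟩
      (approx x (suc n) ℚ.+ approx y (suc n)) ℚ.+ (2^- m ℚ.+ 2^- n) ∎
  }
  where
  open ℚ.≤-Reasoning
  open +-*-Solver
  lemma : ∀ a b d e →
    (a ℚ.+ (½ ℚ.* d ℚ.+ ½ ℚ.* e)) ℚ.+ (b ℚ.+ (½ ℚ.* d ℚ.+ ½ ℚ.* e))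
      ≡ (a ℚ.+ b) ℚ.+ (d ℚ.+ e)
  lemma = solve 4 (λ a b d e →
    (a :+ (con ½ :* d :+ con ½ :* e)) :+ (b :+ (con ½ :* d :+ con ½ :* e))
      := (a :+ b) :+ (d :+ e)) refl

-ᴿ_ : ℝ → ℝ
-ᴿ x = record
  { approx  = λ n → ℚ.- approx x n
  ; regular = λ m n → begin
      ℚ.- approx x m
        ≡⟨ lemma (approx x m) (2^- m) (2^- n) ⟩
      ℚ.- (approx x m ℚ.+ (2^- n ℚ.+ 2^- m)) ℚ.+ (2^- m ℚ.+ 2^- n)
        ≤⟨ ℚ.+-monoˡ-≤ (2^- m ℚ.+ 2^- n) (ℚ.neg-antimono-≤ (regular x n m)) ⟩
      ℚ.- approx x n ℚ.+ (2^- m ℚ.+ 2^- n) ∎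
  }
  where
  open ℚ.≤-Reasoning
  open +-*-Solver
  lemma : ∀ a d e → ℚ.- a ≡ ℚ.- (a ℚ.+ (e ℚ.+ d)) ℚ.+ (d ℚ.+ e)
  lemma = solve 3 (λ a d e → :- a := :- (a :+ (e :+ d)) :+ (d :+ e)) refl

_-ᴿ_ : ℝ → ℝ → ℝ
x -ᴿ y = x +ᴿ (-ᴿ y)

_·_ : ℕ → ℝ → ℝ
zero  · x = 0ᴿ
suc n · x = x +ᴿ n · x

sumᴿ : List ℝ → ℝ
sumᴿ = foldr _+ᴿ_ 0ᴿ

1⊔-pos : ∀ p → ℚ.Positive (1ℚ ℚ.⊔ p)
1⊔-pos p = ℚ.positive (ℚ.<-≤-trans (ℚ.positive⁻¹ 1ℚ) (ℚ.p≤p⊔q 1ℚ p))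

recipℚ : ℚ → ℚ
recipℚ p = (1/ (1ℚ ℚ.⊔ p)) {{ℚ.pos⇒nonZero (1ℚ ℚ.⊔ p) {{1⊔-pos p}}}}

recipℚ-nonNeg : ∀ p → ℚ.NonNegative (recipℚ p)
recipℚ-nonNeg p = ℚ.pos⇒nonNeg (recipℚ p)
  {{ℚ.1/pos⇒pos (1ℚ ℚ.⊔ p) {{1⊔-pos p}}}}

recipℚ-inv : ∀ p → (1ℚ ℚ.⊔ p) ℚ.* recipℚ p ≡ 1ℚ
recipℚ-inv p =
  ℚ.*-inverseʳ (1ℚ ℚ.⊔ p) {{ℚ.pos⇒nonZero (1ℚ ℚ.⊔ p) {{1⊔-pos p}}}}

recipℚ≤1 : ∀ p → recipℚ p ℚ.≤ 1ℚ
recipℚ≤1 p = begin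
  recipℚ p                        ≡⟨ ℚ.*-identityˡ (recipℚ p) ⟨
  1ℚ ℚ.* recipℚ p                 ≤⟨ ℚ.*-monoʳ-≤-nonNeg (recipℚ p) {{recipℚ-nonNeg p}} (ℚ.p≤p⊔q 1ℚ p) ⟩
  (1ℚ ℚ.⊔ p) ℚ.* recipℚ p         ≡⟨ recipℚ-inv p ⟩
  1ℚ                              ∎
  where open ℚ.≤-Reasoning

⊔-lip : ∀ p r e → 0ℚ ℚ.≤ e → p ℚ.≤ r ℚ.+ e → 1ℚ ℚ.⊔ p ℚ.≤ (1ℚ ℚ.⊔ r) ℚ.+ e
⊔-lip p r e 0≤e p≤r+e = ℚ.⊔-lub
  (begin
    1ℚ                    ≡⟨ ℚ.+-identityʳ 1ℚ ⟨
    1ℚ ℚ.+ 0ℚ             ≤⟨ ℚ.+-mono-≤ (ℚ.p≤p⊔q 1ℚ r) 0≤e ⟩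
    (1ℚ ℚ.⊔ r) ℚ.+ e      ∎)
  (begin
    p                     ≤⟨ p≤r+e ⟩
    r ℚ.+ e               ≤⟨ ℚ.+-monoˡ-≤ e (ℚ.p≤q⊔p 1ℚ r) ⟩
    (1ℚ ℚ.⊔ r) ℚ.+ e      ∎)
  where open ℚ.≤-Reasoning

recipℚ-lip : ∀ p r e → 0ℚ ℚ.≤ e → r ℚ.≤ p ℚ.+ e → recipℚ p ℚ.≤ recipℚ r ℚ.+ e
recipℚ-lip p r e 0≤e r≤p+e = begin
  p⁻¹                               ≡⟨ ℚ.*-identityˡ p⁻¹ ⟨
  1ℚ ℚ.* p⁻¹                        ≡⟨ cong (ℚ._* p⁻¹) (recipℚ-inv r) ⟨
  ((1ℚ ℚ.⊔ r) ℚ.* r⁻¹) ℚ.* p⁻¹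
    ≤⟨ ℚ.*-monoʳ-≤-nonNeg p⁻¹ {{recipℚ-nonNeg p}}
        (ℚ.*-monoʳ-≤-nonNeg r⁻¹ {{recipℚ-nonNeg r}} (⊔-lip r p e 0≤e r≤p+e)) ⟩
  (((1ℚ ℚ.⊔ p) ℚ.+ e) ℚ.* r⁻¹) ℚ.* p⁻¹
    ≡⟨ lemma (1ℚ ℚ.⊔ p) e r⁻¹ p⁻¹ ⟩
  ((1ℚ ℚ.⊔ p) ℚ.* p⁻¹) ℚ.* r⁻¹ ℚ.+ (e ℚ.* r⁻¹) ℚ.* p⁻¹
    ≡⟨ cong (λ a → a ℚ.* r⁻¹ ℚ.+ (e ℚ.* r⁻¹) ℚ.* p⁻¹) (recipℚ-inv p) ⟩
  1ℚ ℚ.* r⁻¹ ℚ.+ (e ℚ.* r⁻¹) ℚ.* p⁻¹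
    ≡⟨ cong (ℚ._+ (e ℚ.* r⁻¹) ℚ.* p⁻¹) (ℚ.*-identityˡ r⁻¹) ⟩
  r⁻¹ ℚ.+ (e ℚ.* r⁻¹) ℚ.* p⁻¹
    ≤⟨ ℚ.+-monoʳ-≤ r⁻¹ (ℚ.*-monoʳ-≤-nonNeg p⁻¹ {{recipℚ-nonNeg p}} er≤e) ⟩
  r⁻¹ ℚ.+ e ℚ.* p⁻¹                 ≤⟨ ℚ.+-monoʳ-≤ r⁻¹ (shrink p) ⟩
  r⁻¹ ℚ.+ e                         ∎
  where
  open ℚ.≤-Reasoning
  open +-*-Solver
  p⁻¹ = recipℚ p
  r⁻¹ = recipℚ r
  lemma : ∀ a e s t →
    ((a ℚ.+ e) ℚ.* s) ℚ.* t ≡ (a ℚ.* t) ℚ.* s ℚ.+ (e ℚ.* s) ℚ.* t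
  lemma = solve 4 (λ a e s t →
    ((a :+ e) :* s) :* t := (a :* t) :* s :+ (e :* s) :* t) refl
  shrink : ∀ s → e ℚ.* recipℚ s ℚ.≤ e
  shrink s = begin
    e ℚ.* recipℚ s   ≤⟨ ℚ.*-monoˡ-≤-nonNeg e {{ℚ.nonNegative 0≤e}} (recipℚ≤1 s) ⟩
    e ℚ.* 1ℚ         ≡⟨ ℚ.*-identityʳ e ⟩
    e                ∎
  er≤e = shrink r

-- recip x is 1 / max(1 , x), hence the reciprocal of every real x ≥ 1.
-- Truncating at 1 makes the map total and 1-Lipschitz; the rational
-- approximations of a real x ≥ 1 may themselves lie below 1.
recip : ℝ → ℝ
recip x = record
  { approx  = λ n → recipℚ (approx x n)
  ; regular = λ m n → recipℚ-lip (approx x m) (approx x n) _ (2^-sum≥0 m n) (begin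
      approx x n                              ≤⟨ regular x n m ⟩
      approx x m ℚ.+ (2^- n ℚ.+ 2^- m)        ≡⟨ cong (approx x m ℚ.+_) (ℚ.+-comm (2^- n) (2^- m)) ⟩
      approx x m ℚ.+ (2^- m ℚ.+ 2^- n)        ∎)
  }
  where open ℚ.≤-Reasoning

record Graph : Set where
  field
    v      : ℕ
    adj    : Fin v → Fin v → Bool
    symm   : ∀ x y → adj x y ≡ adj y x
    irrefl : ∀ x → adj x x ≡ false

  Adj : Fin v → Fin v → Set
  Adj x y = T (adj x y)

  edges : List (Fin v × Fin v)
  edges = filter (λ (x , y) → (x Fin.<? y) ×-dec T? (adj x y))
                 (cartesianProduct (allFin v) (allFin v))

  e : ℕ
  e = length edges

  degree : Fin v → ℕ
  degree x = ∣ tabulate (adj x) ∣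

  -- Every degree is less than v, so the starting value v of the fold does
  -- not affect the minimum unless there are no vertices.
  δ : ℕ
  δ = foldr ℕ._⊓_ v (List.map degree (allFin v))

open Graph public

infix 4 _≅_

record _≅_ (G H : Graph) : Set where
  field
    bijection : Fin (v G) ↔ Fin (v H)
    preserves : ∀ x y →
      adj G x y ≡ adj H (Inverse.to bijection x) (Inverse.to bijection y)

InfinitelyMany : Pred Graph 0ℓ → Set
InfinitelyMany P = Σ (ℕ → Graph) λ G →
  (∀ i → P (G i)) × (∀ i j → i ≢ j → ¬ (G i ≅ G j))

-- A copy of K_q in a simple graph is determined by its vertex set.
IsCopy : (q : ℕ) (G : Graph) → Subset (v G) → Set
IsCopy q G S = ∣ S ∣ ≡ q × (∀ x y → x ∈ S → y ∈ S → x ≢ y → Adj G x y)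

isCopy? : ∀ q G S → Dec (IsCopy q G S)
isCopy? q G S = (∣ S ∣ ℕ.≟ q) ×-dec
  Fin.all? λ x → Fin.all? λ y →
    (x ∈? S) →-dec ((y ∈? S) →-dec (¬? (x Fin.≟ y) →-dec T? (adj G x y)))

-- The copy on S contains the edge xy (for an edge xy of the graph).
Contains : ∀ {n} → Subset n → Fin n → Fin n → Set
Contains S x y = x ∈ S × y ∈ S

contains? : ∀ {n} (x y : Fin n) (S : Subset n) → Dec (Contains S x y)
contains? x y S = (x ∈? S) ×-dec (y ∈? S)

-- All subsets of Fin n, each listed exactly once.
subsets : ∀ n → List (Subset n)
subsets zero    = [] ∷ []
subsets (suc n) =
  List.map (outside ∷_) (subsets n) ++ List.map (inside ∷_) (subsets n)

copies : (q : ℕ) (G : Graph) → List (Subset (v G))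
copies q G = filter (isCopy? q G) (subsets (v G))

Divisible : ℕ → Graph → Set
Divisible q G = (q C 2) ∣ e G × (∀ x → (q ∸ 1) ∣ degree G x)

record Decomposition (q : ℕ) (G : Graph) : Set where
  field
    parts     : List (Subset (v G))
    areCopies : All (IsCopy q G) parts
    partition : ∀ x y → Adj G x y →
      ∃! _≡_ λ (i : Fin (length parts)) → Contains (lookup parts i) x y

-- Only the values of weight on copies of K_q matter.
record FractionalDecomposition (q : ℕ) (G : Graph) : Set where
  field
    weight : Subset (v G) → ℝ
    nonNeg : ∀ S → IsCopy q G S → weight S ≥ᴿ 0ᴿ
    total  : ∀ x y → Adj G x y →
      sumᴿ (List.map weight (filter (contains? x y) (copies q G))) ≈ᴿ 1ᴿ

-- Linear programming duality: weights on the edges under which every K_q has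
-- nonnegative weight, while the whole graph has negative weight, exclude any
-- fractional K_q-decomposition. Up to a factor N, the graph has two parts of
-- size 24, each inducing two disjoint copies of K_12, one part of size 18
-- inducing three disjoint copies of K_6, and q - 4 independent sets of size
-- 13, with all edges between different parts; replacing every vertex by N
-- independent ones makes it N(13q + 1)-regular on N(13(q + 1) + 1) vertices.
-- Edges inside the three parts weigh 2, 2 and 1, edges between the first two
-- weigh -1, all others 0. A K_q has at least four vertices in the three parts,
-- say a, b, c of them, and its weight is
--   a(a-1) + b(b-1) + c(c-1)/2 - ab >= 0,
-- since a(a-1) + b(b-1) - ab >= -1 with equality only at a = b = 1, where
-- c >= 2. The total weight is -3N^2, and the minimum degree exceeds the
-- conjectured bound because 24 + 24 + 18 > 5 * 13.

module Submission where

open import Algebra.Bundles using (Ring)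
import Algebra.Properties.Semiring.Sum
open import Data.Bool.Base using (Bool; true; false; T; not; _∧_; _∨_; if_then_else_)
import Data.Bool.Properties as Bool
open import Data.Bool.Properties using (T?)
open import Data.Fin.Base as Fin using (Fin; zero; suc; splitAt; quotient; toℕ)
open import Data.Fin.Patterns using (0F; 1F; 2F)
open import Data.Fin.Permutation using (↔⇒≡)
import Data.Fin.Properties as Fin
open import Data.Fin.Subset using (Subset; ∣_∣; inside; outside)
open import Data.Fin.Subset.Properties using (_∈?_)
open import Data.Integer.Base as ℤ using (+_)
import Data.Integer.Properties as ℤ
open import Data.List.Base as List
  using (List; []; _∷_; filter; length; allFin; cartesianProduct; foldr)
open import Data.List.Membership.Propositional.Properties using (∈-lookup; ∈-filter⁻)
import Data.List.Properties as List
import Data.List.Relation.Unary.All as All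
open import Data.Maybe.Base using (Maybe; just; nothing)
open import Data.Nat.Base as ℕ
  using (ℕ; zero; suc; _+_; _*_; _∸_; _≤_; _<_; _≥_; z≤n; s≤s; _/_; _≡ᵇ_; _<ᵇ_)
open import Data.Nat.Combinatorics using (_C_; nC1≡n; nCk+nC[k+1]≡[n+1]C[k+1])
open import Data.Nat.Divisibility using (_∣_; divides; ∣m⇒∣m*n)
import Data.Nat.Properties as ℕ
open import Data.Nat.Solver using () renaming (module +-*-Solver to ℕ-Solver)
open import Data.Product.Base using (Σ; _×_; _,_; proj₁; proj₂)
open import Data.Rational.Base as ℚ using (ℚ; 0ℚ; 1ℚ; ½; 1/_)
import Data.Rational.Properties as ℚ
open import Data.Rational.Solver using () renaming (module +-*-Solver to ℚ-Solver)
import Data.Rational.Unnormalised.Base as ℚᵘ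
import Data.Rational.Unnormalised.Properties as ℚᵘ
open import Data.Sum.Base as Sum using (_⊎_; inj₁; inj₂)
import Data.Vec.Base as Vec
open Vec using ([]; _∷_)
open import Data.Vec.Properties using (lookup∘tabulate; lookup⇒[]=)
open import Function.Base using (_∘_; id)
open import Level using (0ℓ)
open import Relation.Binary.Definitions using (tri<; tri≈; tri>)
open import Relation.Binary.PropositionalEquality
import Relation.Binary.Reasoning.Setoid
open import Relation.Nullary using (Dec; does; yes; no; ¬_)
open import Relation.Nullary.Decidable using (from-yes; dec-true; dec-false; _×-dec_)
open import Relation.Unary using (Pred; Decidable)
open import Defs

-- Finite sums and indicators.

open Algebra.Properties.Semiring.Sum ℕ.+-*-semiring
  using (sum; sum-cong-≗; ∑-comm; ∑-distrib-+; *-distribˡ-sum; *-distribʳ-sum; sum-replicate-zero)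
open Algebra.Properties.Semiring.Sum (Ring.semiring ℚ.+-*-ring) using () renaming
  ( sum to sumℚ; sum-cong-≗ to sumℚ-cong; ∑-comm to sumℚ-comm; ∑-distrib-+ to sumℚ-distrib-+
  ; *-distribˡ-sum to *-distribˡ-sumℚ )

sum-mono : ∀ {n} {f g : Fin n → ℕ} → (∀ x → f x ≤ g x) → sum f ≤ sum g
sum-mono {zero}  f≤g = z≤n
sum-mono {suc n} f≤g = ℕ.+-mono-≤ (f≤g zero) (sum-mono (f≤g ∘ suc))

sumℚ-mono : ∀ {n} {f g : Fin n → ℚ} → (∀ x → f x ℚ.≤ g x) → sumℚ f ℚ.≤ sumℚ g
sumℚ-mono {zero}  f≤g = ℚ.≤-refl
sumℚ-mono {suc n} f≤g = ℚ.+-mono-≤ (f≤g zero) (sumℚ-mono (f≤g ∘ suc))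

sum-const : ∀ n c → sum {n} (λ _ → c) ≡ n * c
sum-const zero    c = refl
sum-const (suc n) c = cong (_+_ c) (sum-const n c)

sum-splitAt : ∀ m {n} (f : Fin m ⊎ Fin n → ℕ) →
  sum (f ∘ splitAt m) ≡ sum (f ∘ inj₁) + sum (f ∘ inj₂)
sum-splitAt zero    f = refl
sum-splitAt (suc m) f = trans
  (cong (_+_ (f (inj₁ zero))) (sum-splitAt m (f ∘ Sum.map₁ suc)))
  (sym (ℕ.+-assoc (f (inj₁ zero)) _ _))

-- All fibres of `quotient n` have `n` elements; this is how replacing every vertex by `n` copies
-- multiplies sums. On `Fin (suc m * n)` the map is decided by `splitAt n`, which separates the
-- copies of `zero` from the rest.
sum-quotient : ∀ {m} n (f : Fin m → ℕ) → sum (λ x → f (quotient n x)) ≡ n * sum f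
sum-quotient {zero}  n f = sym (ℕ.*-zeroʳ n)
sum-quotient {suc m} n f = begin
  sum (λ x → f (quotient n x))                             ≡⟨ sum-cong-≗ (λ x → step (splitAt n x) refl) ⟩
  sum (λ x → Sum.[ (λ _ → f zero) , (λ y → f (suc (quotient n y))) ] (splitAt n x))
    ≡⟨ sum-splitAt n Sum.[ (λ _ → f zero) , (λ y → f (suc (quotient n y))) ] ⟩
  sum {n} (λ _ → f zero) + sum (λ y → f (suc (quotient n y)))
    ≡⟨ cong₂ _+_ (sum-const n (f zero)) (sum-quotient n (f ∘ suc)) ⟩
  n * f zero + n * sum (f ∘ suc)                           ≡⟨ ℕ.*-distribˡ-+ n (f zero) _ ⟨
  n * (f zero + sum (f ∘ suc))                             ∎
  where
  open ≡-Reasoning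
  step : ∀ {x : Fin (suc m * n)} s → splitAt n x ≡ s →
    f (quotient n x) ≡ Sum.[ (λ _ → f zero) , (λ y → f (suc (quotient n y))) ] s
  step (inj₁ _) eq rewrite eq = refl
  step (inj₂ _) eq rewrite eq = refl

ind : Bool → ℕ
ind false = 0
ind true  = 1

sum-at : ∀ {n} (x : Fin n) (f : Fin n → ℕ) → sum (λ y → ind (does (x Fin.≟ y)) * f y) ≡ f x
sum-at {suc n} zero    f = trans (cong₂ _+_ (ℕ.+-identityʳ _) (sum-replicate-zero n)) (ℕ.+-identityʳ _)
sum-at {suc n} (suc x) f = sum-at x (f ∘ suc)

-- This will bound how often a clique meets an independent set.
sum-ind≤1 : ∀ {n} (b : Fin n → Bool) → (∀ x y → T (b x) → T (b y) → x ≡ y) → sum (ind ∘ b) ≤ 1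
sum-ind≤1 {zero}  b unique = z≤n
sum-ind≤1 {suc n} b unique with b zero in eq
... | false = sum-ind≤1 (b ∘ suc) (λ x y p q → Fin.suc-injective (unique (suc x) (suc y) p q))
... | true  = s≤s (ℕ.≤-reflexive (trans (sum-cong-≗ vanish) (sum-replicate-zero n)))
  where
  vanish : ∀ x → ind (b (suc x)) ≡ 0
  vanish x with b (suc x) in eq′
  ... | false = refl
  ... | true  with () ← unique zero (suc x) (subst T (sym eq) _) (subst T (sym eq′) _)

-- The embedding of the naturals into the rationals.

ι : ℕ → ℚ
ι n = + n ℚ./ 1

ι≃ : ∀ n → ℚ.toℚᵘ (ι n) ℚᵘ.≃ ℚᵘ.mkℚᵘ (+ n) 0
ι≃ n = ℚ.toℚᵘ-fromℚᵘ (ℚᵘ.mkℚᵘ (+ n) 0)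

-- The fraction in `ι` is reduced by a gcd that does not compute on variables. Among unnormalised
-- rationals the denominators stay 1 and the identity is one of integers.
ι-+ : ∀ m n → ι (m + n) ≡ ι m ℚ.+ ι n
ι-+ m n = ℚ.toℚᵘ-injective (begin
  ℚ.toℚᵘ (ι (m + n))                      ≈⟨ ι≃ (m + n) ⟩
  ℚᵘ.mkℚᵘ (+ (m + n)) 0                   ≈⟨ ℚᵘ.*≡* (cong (ℤ._* + 1) (sym (cong₂ ℤ._+_ (ℤ.*-identityʳ (+ m)) (ℤ.*-identityʳ (+ n))))) ⟩
  ℚᵘ.mkℚᵘ (+ m) 0 ℚᵘ.+ ℚᵘ.mkℚᵘ (+ n) 0    ≈⟨ ℚᵘ.+-cong (ι≃ m) (ι≃ n) ⟨
  ℚ.toℚᵘ (ι m) ℚᵘ.+ ℚ.toℚᵘ (ι n)          ≈⟨ ℚ.toℚᵘ-homo-+ (ι m) (ι n) ⟨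
  ℚ.toℚᵘ (ι m ℚ.+ ι n)                    ∎)
  where open Relation.Binary.Reasoning.Setoid ℚᵘ.≃-setoid

ι-* : ∀ m n → ι (m * n) ≡ ι m ℚ.* ι n
ι-* m n = ℚ.toℚᵘ-injective (begin
  ℚ.toℚᵘ (ι (m * n))                      ≈⟨ ι≃ (m * n) ⟩
  ℚᵘ.mkℚᵘ (+ (m * n)) 0                   ≈⟨ ℚᵘ.*≡* (cong (ℤ._* + 1) (ℤ.pos-* m n)) ⟩
  ℚᵘ.mkℚᵘ (+ m) 0 ℚᵘ.* ℚᵘ.mkℚᵘ (+ n) 0    ≈⟨ ℚᵘ.*-cong (ι≃ m) (ι≃ n) ⟨
  ℚ.toℚᵘ (ι m) ℚᵘ.* ℚ.toℚᵘ (ι n)          ≈⟨ ℚ.toℚᵘ-homo-* (ι m) (ι n) ⟨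
  ℚ.toℚᵘ (ι m ℚ.* ι n)                    ∎)
  where open Relation.Binary.Reasoning.Setoid ℚᵘ.≃-setoid

ι-sum : ∀ {n} (f : Fin n → ℕ) → ι (sum f) ≡ sumℚ (ι ∘ f)
ι-sum {zero}  f = refl
ι-sum {suc n} f = trans (ι-+ (f zero) _) (cong (ι (f zero) ℚ.+_) (ι-sum (f ∘ suc)))

ι≥0 : ∀ n → 0ℚ ℚ.≤ ι n
ι≥0 n = ℚ.nonNegative⁻¹ (ι n) {{ℚ.normalize-nonNeg n 1}}

ι-mono : ∀ {m n} → m ≤ n → ι m ℚ.≤ ι n
ι-mono {m} {n} m≤n = begin
  ι m                    ≡⟨ ℚ.+-identityʳ (ι m) ⟨
  ι m ℚ.+ 0ℚ             ≤⟨ ℚ.+-monoʳ-≤ (ι m) (ι≥0 (n ℕ.∸ m)) ⟩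
  ι m ℚ.+ ι (n ℕ.∸ m)    ≡⟨ ι-+ m (n ℕ.∸ m) ⟨
  ι (m + (n ℕ.∸ m))      ≡⟨ cong ι (ℕ.m+[n∸m]≡n m≤n) ⟩
  ι n                    ∎
  where open ℚ.≤-Reasoning

-- Characteristic functions of subsets and sums over ordered pairs.

χ : ∀ {n} → Subset n → Fin n → ℕ
χ S x = ind (Vec.lookup S x)

∣S∣≡sum : ∀ {n} (S : Subset n) → ∣ S ∣ ≡ sum (χ S)
∣S∣≡sum []            = refl
∣S∣≡sum (outside ∷ S) = ∣S∣≡sum S
∣S∣≡sum (inside ∷ S)  = cong suc (∣S∣≡sum S)

does-∈? : ∀ {n} (x : Fin n) (S : Subset n) → does (x ∈? S) ≡ Vec.lookup S x
does-∈? zero    (outside ∷ S) = refl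
does-∈? zero    (inside ∷ S)  = refl
does-∈? (suc x) (s ∷ S)       = does-∈? x S

ind-∧ : ∀ a b → ind (a ∧ b) ≡ ind a * ind b
ind-∧ false b = refl
ind-∧ true  b = sym (ℕ.+-identityʳ (ind b))

ind-contains : ∀ {n} (x y : Fin n) (S : Subset n) →
  ind (does (contains? x y S)) ≡ χ S x * χ S y
ind-contains x y S = trans (ind-∧ (does (x ∈? S)) (does (y ∈? S)))
  (cong₂ _*_ (cong ind (does-∈? x S)) (cong ind (does-∈? y S)))

total : ∀ {m n} → (Fin m → Fin n → ℕ) → ℕ
total W = sum λ x → sum (W x)

within : ∀ {n} → Subset n → (Fin n → Fin n → ℕ) → ℕ
within S W = total λ x y → χ S x * χ S y * W x y

ι-total : ∀ {m n} (W : Fin m → Fin n → ℕ) → ι (total W) ≡ sumℚ λ x → sumℚ λ y → ι (W x y)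
ι-total W = trans (ι-sum (λ x → sum (W x))) (sumℚ-cong λ x → ι-sum (W x))

*-distribˡ-sumℚ² : ∀ {m n} p (W : Fin m → Fin n → ℚ) →
  p ℚ.* (sumℚ λ x → sumℚ (W x)) ≡ sumℚ λ x → sumℚ λ y → p ℚ.* W x y
*-distribˡ-sumℚ² p W = trans (*-distribˡ-sumℚ p (λ x → sumℚ (W x)))
  (sumℚ-cong λ x → *-distribˡ-sumℚ p (W x))

sumℚ²-mono : ∀ {m n} {f g : Fin m → Fin n → ℚ} → (∀ x y → f x y ℚ.≤ g x y) →
  (sumℚ λ x → sumℚ (f x)) ℚ.≤ (sumℚ λ x → sumℚ (g x))
sumℚ²-mono f≤g = sumℚ-mono λ x → sumℚ-mono (f≤g x)

-- Double counting and weak duality.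

coverage : ∀ {n m} → (Fin m → Subset n) → (Fin m → ℚ) → Fin n → Fin n → ℚ
coverage S f x y = sumℚ λ i → f i ℚ.* ι (χ (S i) x * χ (S i) y)

-- Both sides add up `f i` times `W x y` over all `i` and all ordered pairs from `S i`; only the
-- order of summation differs.
double-count : ∀ {n m} (S : Fin m → Subset n) (f : Fin m → ℚ) (W : Fin n → Fin n → ℕ) →
  (sumℚ λ x → sumℚ λ y → ι (W x y) ℚ.* coverage S f x y) ≡ sumℚ λ i → f i ℚ.* ι (within (S i) W)
double-count S f W = begin
  (sumℚ λ x → sumℚ λ y → ι (W x y) ℚ.* coverage S f x y)
    ≡⟨ (sumℚ-cong λ x → trans (sumℚ-cong λ y → expand x y) (sumℚ-comm (λ y i → term x y i))) ⟩
  (sumℚ λ x → sumℚ λ i → sumℚ λ y → term x y i)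
    ≡⟨ sumℚ-comm (λ x i → sumℚ λ y → term x y i) ⟩
  (sumℚ λ i → sumℚ λ x → sumℚ λ y → term x y i)
    ≡⟨ (sumℚ-cong λ i → sym (trans (cong (f i ℚ.*_) (ι-total λ x y → χ (S i) x * χ (S i) y * W x y))
           (*-distribˡ-sumℚ² (f i) λ x y → ι (χ (S i) x * χ (S i) y * W x y)))) ⟩
  (sumℚ λ i → f i ℚ.* ι (within (S i) W)) ∎
  where
  open ≡-Reasoning
  open ℚ-Solver
  term = λ x y i → f i ℚ.* ι (χ (S i) x * χ (S i) y * W x y)
  rearrange : ∀ w a c → w ℚ.* (a ℚ.* c) ≡ a ℚ.* (c ℚ.* w)
  rearrange = solve 3 (λ w a c → w :* (a :* c) := a :* (c :* w)) refl
  expand : ∀ x y → ι (W x y) ℚ.* coverage S f x y ≡ sumℚ (term x y)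
  expand x y = trans (*-distribˡ-sumℚ (ι (W x y)) (λ i → f i ℚ.* ι (χ (S i) x * χ (S i) y))) (sumℚ-cong λ i →
    trans (rearrange (ι (W x y)) (f i) (ι (χ (S i) x * χ (S i) y))) (cong (f i ℚ.*_) (sym (ι-* (χ (S i) x * χ (S i) y) (W x y)))))

module _ {n} (adj : Fin n → Fin n → Bool) (P Q : Fin n → Fin n → ℕ)
  (P-support : ∀ x y → adj x y ≡ false → P x y ≡ 0)
  (Q-support : ∀ x y → adj x y ≡ false → Q x y ≡ 0)
  where

  -- The dual weight `P - Q` is split so that both halves are natural numbers. The lower bound on
  -- the coverage is tested against `Q`, the upper bound against `P`, and double counting links the
  -- two through the sets `S i`. Off the edges both weights vanish. The errors `a` and `b` leave
  -- room for coverage that is 1 only approximately.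
  weak-duality : ∀ {m} (S : Fin m → Subset n) (f : Fin m → ℚ) (a b : ℚ) →
    (∀ i → within (S i) Q ≤ within (S i) P) → (∀ i → 0ℚ ℚ.≤ f i) →
    (∀ x y → T (adj x y) → 1ℚ ℚ.≤ coverage S f x y ℚ.+ a) →
    (∀ x y → T (adj x y) → coverage S f x y ℚ.≤ 1ℚ ℚ.+ b) →
    ι (total Q) ℚ.≤ (1ℚ ℚ.+ b) ℚ.* ι (total P) ℚ.+ a ℚ.* ι (total Q)
  weak-duality S f a b Q≤P f≥0 lower upper = begin
    ι (total Q)
      ≡⟨ ι-total Q ⟩
    (sumℚ λ x → sumℚ λ y → ι (Q x y))
      ≤⟨ sumℚ²-mono (λ x y → lower′ x y (adj x y) refl) ⟩
    (sumℚ λ x → sumℚ λ y → ι (Q x y) ℚ.* coverage S f x y ℚ.+ a ℚ.* ι (Q x y))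
      ≡⟨ trans (sumℚ-cong λ x → sumℚ-distrib-+ (λ y → ι (Q x y) ℚ.* coverage S f x y) (λ y → a ℚ.* ι (Q x y)))
           (sumℚ-distrib-+ (λ x → sumℚ λ y → ι (Q x y) ℚ.* coverage S f x y) (λ x → sumℚ λ y → a ℚ.* ι (Q x y))) ⟩
    (sumℚ λ x → sumℚ λ y → ι (Q x y) ℚ.* coverage S f x y) ℚ.+ (sumℚ λ x → sumℚ λ y → a ℚ.* ι (Q x y))
      ≡⟨ cong₂ ℚ._+_ (double-count S f Q) (sym (trans (cong (a ℚ.*_) (ι-total Q)) (*-distribˡ-sumℚ² a λ x y → ι (Q x y)))) ⟩
    (sumℚ λ i → f i ℚ.* ι (within (S i) Q)) ℚ.+ a ℚ.* ι (total Q)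
      ≤⟨ ℚ.+-monoˡ-≤ (a ℚ.* ι (total Q)) (sumℚ-mono λ i →
           ℚ.*-monoˡ-≤-nonNeg (f i) {{ℚ.nonNegative (f≥0 i)}} (ι-mono (Q≤P i))) ⟩
    (sumℚ λ i → f i ℚ.* ι (within (S i) P)) ℚ.+ a ℚ.* ι (total Q)
      ≡⟨ cong (ℚ._+ a ℚ.* ι (total Q)) (double-count S f P) ⟨
    (sumℚ λ x → sumℚ λ y → ι (P x y) ℚ.* coverage S f x y) ℚ.+ a ℚ.* ι (total Q)
      ≤⟨ ℚ.+-monoˡ-≤ (a ℚ.* ι (total Q)) (sumℚ²-mono (λ x y → upper′ x y (adj x y) refl)) ⟩
    (sumℚ λ x → sumℚ λ y → (1ℚ ℚ.+ b) ℚ.* ι (P x y)) ℚ.+ a ℚ.* ι (total Q)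
      ≡⟨ cong (ℚ._+ a ℚ.* ι (total Q)) (trans (cong ((1ℚ ℚ.+ b) ℚ.*_) (ι-total P)) (*-distribˡ-sumℚ² (1ℚ ℚ.+ b) λ x y → ι (P x y))) ⟨
    (1ℚ ℚ.+ b) ℚ.* ι (total P) ℚ.+ a ℚ.* ι (total Q) ∎
    where
    open ℚ.≤-Reasoning
    lower′ : ∀ x y c → adj x y ≡ c → ι (Q x y) ℚ.≤ ι (Q x y) ℚ.* coverage S f x y ℚ.+ a ℚ.* ι (Q x y)
    lower′ x y false eq rewrite Q-support x y eq = ℚ.≤-reflexive
      (sym (cong₂ ℚ._+_ (ℚ.*-zeroˡ (coverage S f x y)) (ℚ.*-zeroʳ a)))
    lower′ x y true  eq = begin
      ι (Q x y)                                    ≡⟨ ℚ.*-identityʳ (ι (Q x y)) ⟨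
      ι (Q x y) ℚ.* 1ℚ                             ≤⟨ ℚ.*-monoˡ-≤-nonNeg (ι (Q x y)) {{ℚ.nonNegative (ι≥0 (Q x y))}} (lower x y (subst T (sym eq) _)) ⟩
      ι (Q x y) ℚ.* (coverage S f x y ℚ.+ a)       ≡⟨ ℚ.*-distribˡ-+ (ι (Q x y)) (coverage S f x y) a ⟩
      ι (Q x y) ℚ.* coverage S f x y ℚ.+ ι (Q x y) ℚ.* a
        ≡⟨ cong (ι (Q x y) ℚ.* coverage S f x y ℚ.+_) (ℚ.*-comm (ι (Q x y)) a) ⟩
      ι (Q x y) ℚ.* coverage S f x y ℚ.+ a ℚ.* ι (Q x y) ∎
    upper′ : ∀ x y c → adj x y ≡ c → ι (P x y) ℚ.* coverage S f x y ℚ.≤ (1ℚ ℚ.+ b) ℚ.* ι (P x y)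
    upper′ x y false eq rewrite P-support x y eq = ℚ.≤-reflexive
      (trans (ℚ.*-zeroˡ (coverage S f x y)) (sym (ℚ.*-zeroʳ (1ℚ ℚ.+ b))))
    upper′ x y true  eq = begin
      ι (P x y) ℚ.* coverage S f x y    ≤⟨ ℚ.*-monoˡ-≤-nonNeg (ι (P x y)) {{ℚ.nonNegative (ι≥0 (P x y))}} (upper x y (subst T (sym eq) _)) ⟩
      ι (P x y) ℚ.* (1ℚ ℚ.+ b)          ≡⟨ ℚ.*-comm (ι (P x y)) (1ℚ ℚ.+ b) ⟩
      (1ℚ ℚ.+ b) ℚ.* ι (P x y)          ∎

-- Rational approximation of real weights.

2^->0 : ∀ n → 0ℚ ℚ.< 2^- n
2^->0 zero    = ℚ.positive⁻¹ 1ℚ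
2^->0 (suc n) = begin-strict
  0ℚ           ≡⟨ ℚ.*-zeroʳ ½ ⟨
  ½ ℚ.* 0ℚ     <⟨ ℚ.*-monoʳ-<-pos ½ (2^->0 n) ⟩
  ½ ℚ.* 2^- n  ∎
  where open ℚ.≤-Reasoning

-- By induction, as `2 + n` is at most `2 * suc n`. It fixes the precision in the fractional case
-- and separates the constant of the theorem from 1.
suc-n*2^-n≤1 : ∀ n → ι (suc n) ℚ.* 2^- n ℚ.≤ 1ℚ
suc-n*2^-n≤1 zero    = ℚ.≤-refl
suc-n*2^-n≤1 (suc n) = begin
  ι (2 + n) ℚ.* (½ ℚ.* 2^- n)
    ≤⟨ ℚ.*-monoʳ-≤-nonNeg (2^- (suc n)) {{ℚ.nonNegative (2^-≥0 (suc n))}}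
         (ι-mono (s≤s (ℕ.≤-trans (ℕ.m≤n+m (suc n) n) (ℕ.≤-reflexive (cong (_+_ n) (sym (ℕ.+-identityʳ (suc n)))))))) ⟩
  ι (2 * suc n) ℚ.* (½ ℚ.* 2^- n)           ≡⟨ cong (ℚ._* (½ ℚ.* 2^- n)) (ι-* 2 (suc n)) ⟩
  (ι 2 ℚ.* ι (suc n)) ℚ.* (½ ℚ.* 2^- n)     ≡⟨ halve (ι (suc n)) (2^- n) ⟩
  ι (suc n) ℚ.* 2^- n                       ≤⟨ suc-n*2^-n≤1 n ⟩
  1ℚ                                        ∎
  where
  open ℚ.≤-Reasoning
  open ℚ-Solver
  halve : ∀ p e → (ι 2 ℚ.* p) ℚ.* (½ ℚ.* e) ≡ p ℚ.* e
  halve = solve 2 (λ p e → (con (ι 2) :* p) :* (con ½ :* e) := p :* e) refl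

-- A rational approximation of the weights, at a precision K common to all
-- summands: the approximations used by sumᴿ depend on the position in the
-- list. The shift by 2ε makes the approximations nonnegative.
module _ {n} (x y : Fin n) (weight : Subset n → ℝ) (K : ℕ) where

  private
    ε = 2^- K

  shifted : Subset n → ℚ
  shifted S = approx (weight S) K ℚ.+ (ε ℚ.+ ε)

  private
    covered : List (Subset n) → ℝ
    covered L = sumᴿ (List.map weight (filter (contains? x y) L))

    cover : List (Subset n) → ℚ
    cover L = coverage (List.lookup L) (shifted ∘ List.lookup L) x y

  -- The error does not grow with the list: `_+ᴿ_` evaluates both summands at `suc k`, so each step
  -- splits `2^- k` into two halves, and the error `ε` of passing from precision `suc k` to `K` is
  -- absorbed by the shift. The induction needs all `k` at once.
  approx-covered≤ : ∀ L k → approx (covered L) k ℚ.≤ cover L ℚ.+ 2^- k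
  approx-covered≤ []      k = ℚ.+-monoʳ-≤ 0ℚ (2^-≥0 k)
  -- The product of the `χ` becomes the indicator of the very decision that `filter` makes, so one
  -- case split settles both sides.
  approx-covered≤ (S ∷ L) k rewrite sym (ind-contains x y S) with does (contains? x y S)
  ... | false = begin
    approx (covered L) k                   ≤⟨ approx-covered≤ L k ⟩
    cover L ℚ.+ 2^- k                      ≡⟨ drop (shifted S) (cover L) (2^- k) ⟩
    (shifted S ℚ.* ι 0 ℚ.+ cover L) ℚ.+ 2^- k ∎
    where
    open ℚ.≤-Reasoning
    open ℚ-Solver
    drop : ∀ s c d → c ℚ.+ d ≡ (s ℚ.* ι 0 ℚ.+ c) ℚ.+ d
    drop = solve 3 (λ s c d → c :+ d := (s :* con (ι 0) :+ c) :+ d) refl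
  ... | true = begin
    approx (weight S) (suc k) ℚ.+ approx (covered L) (suc k)
      ≤⟨ ℚ.+-mono-≤ (ℚ.≤-trans (regular (weight S) (suc k) K)
           (p≤p+q (approx (weight S) K ℚ.+ (½ ℚ.* 2^- k ℚ.+ ε)) ε (2^-≥0 K))) (approx-covered≤ L (suc k)) ⟩
    ((approx (weight S) K ℚ.+ (½ ℚ.* 2^- k ℚ.+ ε)) ℚ.+ ε) ℚ.+ (cover L ℚ.+ ½ ℚ.* 2^- k)
      ≡⟨ collect (approx (weight S) K) (2^- k) ε (cover L) ⟩
    (shifted S ℚ.* ι 1 ℚ.+ cover L) ℚ.+ 2^- k ∎
    where
    open ℚ.≤-Reasoning
    open ℚ-Solver
    p≤p+q : ∀ p q → 0ℚ ℚ.≤ q → p ℚ.≤ p ℚ.+ q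
    p≤p+q p q 0≤q = ℚ.≤-trans (ℚ.≤-reflexive (sym (ℚ.+-identityʳ p))) (ℚ.+-monoʳ-≤ p 0≤q)
    collect : ∀ p d e c → ((p ℚ.+ (½ ℚ.* d ℚ.+ e)) ℚ.+ e) ℚ.+ (c ℚ.+ ½ ℚ.* d)
                        ≡ ((p ℚ.+ (e ℚ.+ e)) ℚ.* ι 1 ℚ.+ c) ℚ.+ d
    collect = solve 4 (λ p d e c → ((p :+ (con ½ :* d :+ e)) :+ e) :+ (c :+ con ½ :* d)
                        := ((p :+ (e :+ e)) :* con (ι 1) :+ c) :+ d) refl

  -- In this direction the shift counts as error: every covering set costs `2ε` for the shift and
  -- `ε` for the change of precision, hence `3ε` per list entry.
  ≤approx-covered : ∀ L k → cover L ℚ.≤ (approx (covered L) k ℚ.+ 2^- k) ℚ.+ ι (3 * length L) ℚ.* ε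
  ≤approx-covered []      k = begin
    0ℚ                          ≤⟨ 2^-≥0 k ⟩
    2^- k                       ≡⟨ pad (2^- k) ε ⟩
    (ι 0 ℚ.+ 2^- k) ℚ.+ ι 0 ℚ.* ε ∎
    where
    open ℚ.≤-Reasoning
    open ℚ-Solver
    pad : ∀ d e → d ≡ (ι 0 ℚ.+ d) ℚ.+ ι 0 ℚ.* e
    pad = solve 2 (λ d e → d := (con (ι 0) :+ d) :+ con (ι 0) :* e) refl
  ≤approx-covered (S ∷ L) k rewrite sym (ind-contains x y S) with does (contains? x y S)
  ... | false = begin
    shifted S ℚ.* ι 0 ℚ.+ cover L
      ≡⟨ drop (shifted S) (cover L) ⟩
    cover L
      ≤⟨ ≤approx-covered L k ⟩
    (approx (covered L) k ℚ.+ 2^- k) ℚ.+ ι (3 * length L) ℚ.* ε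
      ≤⟨ ℚ.+-monoʳ-≤ (approx (covered L) k ℚ.+ 2^- k) (ℚ.*-monoʳ-≤-nonNeg ε {{ℚ.nonNegative (2^-≥0 K)}}
           (ι-mono (ℕ.*-monoʳ-≤ 3 (ℕ.n≤1+n (length L))))) ⟩
    (approx (covered L) k ℚ.+ 2^- k) ℚ.+ ι (3 * suc (length L)) ℚ.* ε ∎
    where
    open ℚ.≤-Reasoning
    open ℚ-Solver
    drop : ∀ s c → s ℚ.* ι 0 ℚ.+ c ≡ c
    drop = solve 2 (λ s c → s :* con (ι 0) :+ c := c) refl
  ... | true = begin
    shifted S ℚ.* ι 1 ℚ.+ cover L
      ≤⟨ ℚ.+-mono-≤ (ℚ.*-monoʳ-≤-nonNeg (ι 1) (ℚ.+-monoˡ-≤ (ε ℚ.+ ε) (regular (weight S) K (suc k))))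
                    (≤approx-covered L (suc k)) ⟩
    ((approx (weight S) (suc k) ℚ.+ (ε ℚ.+ ½ ℚ.* 2^- k)) ℚ.+ (ε ℚ.+ ε)) ℚ.* ι 1
      ℚ.+ ((approx (covered L) (suc k) ℚ.+ ½ ℚ.* 2^- k) ℚ.+ ι (3 * length L) ℚ.* ε)
      ≡⟨ collect (approx (weight S) (suc k)) (2^- k) ε (approx (covered L) (suc k)) (ι (3 * length L)) ⟩
    ((approx (weight S) (suc k) ℚ.+ approx (covered L) (suc k)) ℚ.+ 2^- k) ℚ.+ (ι 3 ℚ.+ ι (3 * length L)) ℚ.* ε
      ≡⟨ cong (λ z → ((approx (weight S) (suc k) ℚ.+ approx (covered L) (suc k)) ℚ.+ 2^- k) ℚ.+ z ℚ.* ε)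
           (trans (sym (ι-+ 3 (3 * length L))) (cong ι (sym (ℕ.*-suc 3 (length L))))) ⟩
    ((approx (weight S) (suc k) ℚ.+ approx (covered L) (suc k)) ℚ.+ 2^- k) ℚ.+ ι (3 * suc (length L)) ℚ.* ε ∎
    where
    open ℚ.≤-Reasoning
    open ℚ-Solver
    collect : ∀ p d e c l →
      ((p ℚ.+ (e ℚ.+ ½ ℚ.* d)) ℚ.+ (e ℚ.+ e)) ℚ.* ι 1 ℚ.+ ((c ℚ.+ ½ ℚ.* d) ℚ.+ l ℚ.* e)
      ≡ ((p ℚ.+ c) ℚ.+ d) ℚ.+ (ι 3 ℚ.+ l) ℚ.* e
    collect = solve 5 (λ p d e c l →
      ((p :+ (e :+ con ½ :* d)) :+ (e :+ e)) :* con (ι 1) :+ ((c :+ con ½ :* d) :+ l :* e)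
      := ((p :+ c) :+ d) :+ (con (ι 3) :+ l) :* e) refl

-- Dual weights exclude both kinds of decomposition.

module _ {q} (G : Graph) (P Q : Fin (v G) → Fin (v G) → ℕ)
  (P-support : ∀ x y → adj G x y ≡ false → P x y ≡ 0)
  (Q-support : ∀ x y → adj G x y ≡ false → Q x y ≡ 0)
  (Q≤P : ∀ S → IsCopy q G S → within S Q ≤ within S P)
  (P<Q : total P < total Q)
  where

  -- With weight 1 on each part, every edge is covered exactly once. Weak duality without errors
  -- then contradicts `P<Q`.
  ¬decomposition : ¬ Decomposition q G
  ¬decomposition D = ℚ.<-irrefl refl (ℚ.<-≤-trans ιP<ιQ (begin
    ι (total Q)
      ≤⟨ weak-duality (adj G) P Q P-support Q-support (List.lookup parts) (λ _ → 1ℚ) 0ℚ 0ℚ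
           (λ i → Q≤P _ (All.lookup areCopies (∈-lookup i)))
           (λ _ → ℚ.nonNegative⁻¹ 1ℚ)
           (λ x y xy → ℚ.≤-reflexive (trans (sym (cover≡1 x y xy)) (sym (ℚ.+-identityʳ _))))
           (λ x y xy → ℚ.≤-reflexive (cover≡1 x y xy)) ⟩
    (1ℚ ℚ.+ 0ℚ) ℚ.* ι (total P) ℚ.+ 0ℚ ℚ.* ι (total Q)
      ≡⟨ cong₂ ℚ._+_ (ℚ.*-identityˡ (ι (total P))) (ℚ.*-zeroˡ (ι (total Q))) ⟩
    ι (total P) ℚ.+ 0ℚ
      ≡⟨ ℚ.+-identityʳ (ι (total P)) ⟩
    ι (total P) ∎))
    where
    open ℚ.≤-Reasoning
    open Decomposition D
    ιP<ιQ : ι (total P) ℚ.< ι (total Q)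
    ιP<ιQ = begin-strict
      ι (total P)            ≡⟨ ℚ.+-identityˡ (ι (total P)) ⟨
      0ℚ ℚ.+ ι (total P)     <⟨ ℚ.+-monoˡ-< (ι (total P)) (ℚ.positive⁻¹ 1ℚ) ⟩
      1ℚ ℚ.+ ι (total P)     ≡⟨ ι-+ 1 (total P) ⟨
      ι (suc (total P))      ≤⟨ ι-mono P<Q ⟩
      ι (total Q)            ∎
    cover≡1 : ∀ x y → Adj G x y → coverage (List.lookup parts) (λ _ → 1ℚ) x y ≡ 1ℚ
    cover≡1 x y xy with j , j-contains , j-unique ← partition x y xy =
      trans (sumℚ-cong λ i → ℚ.*-identityˡ (ι (χ (List.lookup parts i) x * χ (List.lookup parts i) y)))
        (trans (sym (ι-sum λ i → χ (List.lookup parts i) x * χ (List.lookup parts i) y)) (cong ι (trans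
        (sum-cong-≗ λ i → trans (sym (ind-contains x y (List.lookup parts i))) (only-j i (j Fin.≟ i)))
        (sum-at j (λ _ → 1)))))
      where
      only-j : ∀ i (d : Dec (j ≡ i)) →
        ind (does (contains? x y (List.lookup parts i))) ≡ ind (does d) * 1
      only-j i (yes refl) = cong ind (dec-true (contains? x y _) j-contains)
      only-j i (no j≢i)   = cong ind (dec-false (contains? x y _) (j≢i ∘ j-unique))

  -- The totals are natural numbers, so they differ by at least 1, and weak duality yields
  -- `1 ≤ K * ε`. But `(K + 1) * ε ≤ 1` by the choice of `ε`, which forces `ε ≤ 0`.
  ¬fractionalDecomposition : ¬ FractionalDecomposition q G
  ¬fractionalDecomposition F = ℚ.<-irrefl refl (ℚ.<-≤-trans (2^->0 K) (begin
    ε                                        ≡⟨ lhs p ε ⟩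
    (1ℚ ℚ.+ p) ℚ.+ (ε ℚ.+ (ℚ.- (1ℚ ℚ.+ p)))
      ≤⟨ ℚ.+-monoˡ-≤ _ (ℚ.≤-trans (ℚ.≤-reflexive (sym (ι-+ 1 (total P)))) (ℚ.≤-trans (ι-mono P<Q) bound)) ⟩
    ((1ℚ ℚ.+ (ι 3 ℚ.* ε ℚ.+ ι (3 * l) ℚ.* ε)) ℚ.* p ℚ.+ ι 3 ℚ.* ε ℚ.* r) ℚ.+ (ε ℚ.+ (ℚ.- (1ℚ ℚ.+ p)))
      ≡⟨ regroup p r ε (ι (3 * l)) ⟩
    (1ℚ ℚ.+ ((ι 3 ℚ.+ ι (3 * l)) ℚ.* p ℚ.+ ι 3 ℚ.* r)) ℚ.* ε ℚ.+ (ℚ.- 1ℚ)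
      ≡⟨ cong (λ z → (1ℚ ℚ.+ z) ℚ.* ε ℚ.+ (ℚ.- 1ℚ)) ι-K ⟨
    (1ℚ ℚ.+ ι K) ℚ.* ε ℚ.+ (ℚ.- 1ℚ)
      ≡⟨ cong (λ z → z ℚ.* ε ℚ.+ (ℚ.- 1ℚ)) (ι-+ 1 K) ⟨
    ι (suc K) ℚ.* ε ℚ.+ (ℚ.- 1ℚ)
      ≤⟨ ℚ.+-monoˡ-≤ (ℚ.- 1ℚ) (suc-n*2^-n≤1 K) ⟩
    0ℚ ∎))
    where
    open ℚ.≤-Reasoning
    open ℚ-Solver
    open FractionalDecomposition F renaming (total to covers)
    L = copies q G
    l = length L
    -- The coefficient of `ε` in the error of weak duality: an excess of coverage up to
    -- `(3 + 3 * l) * ε` is weighted by `total P`, a deficit up to `3 * ε` by `total Q`.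
    K = (3 + 3 * l) * total P + 3 * total Q
    ε = 2^- K
    p = ι (total P)
    r = ι (total Q)
    ι-K : ι K ≡ (ι 3 ℚ.+ ι (3 * l)) ℚ.* p ℚ.+ ι 3 ℚ.* r
    ι-K = trans (ι-+ ((3 + 3 * l) * total P) (3 * total Q)) (cong₂ ℚ._+_
      (trans (ι-* (3 + 3 * l) (total P)) (cong (ℚ._* p) (ι-+ 3 (3 * l)))) (ι-* 3 (total Q)))
    lhs : ∀ p e → e ≡ (1ℚ ℚ.+ p) ℚ.+ (e ℚ.+ (ℚ.- (1ℚ ℚ.+ p)))
    lhs = solve 2 (λ p e → e := (con 1ℚ :+ p) :+ (e :+ (:- (con 1ℚ :+ p)))) refl
    regroup : ∀ p r e k →
      ((1ℚ ℚ.+ (ι 3 ℚ.* e ℚ.+ k ℚ.* e)) ℚ.* p ℚ.+ ι 3 ℚ.* e ℚ.* r) ℚ.+ (e ℚ.+ (ℚ.- (1ℚ ℚ.+ p)))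
      ≡ (1ℚ ℚ.+ ((ι 3 ℚ.+ k) ℚ.* p ℚ.+ ι 3 ℚ.* r)) ℚ.* e ℚ.+ (ℚ.- 1ℚ)
    regroup = solve 4 (λ p r e k →
      ((con 1ℚ :+ (con (ι 3) :* e :+ k :* e)) :* p :+ con (ι 3) :* e :* r) :+ (e :+ (:- (con 1ℚ :+ p)))
      := (con 1ℚ :+ ((con (ι 3) :+ k) :* p :+ con (ι 3) :* r)) :* e :+ con (ℚ.- 1ℚ)) refl
    copy : ∀ i → IsCopy q G (List.lookup L i)
    copy i = proj₂ (∈-filter⁻ (isCopy? q G) {xs = subsets (v G)} (∈-lookup i))
    bound : r ℚ.≤ (1ℚ ℚ.+ (ι 3 ℚ.* ε ℚ.+ ι (3 * l) ℚ.* ε)) ℚ.* p ℚ.+ ι 3 ℚ.* ε ℚ.* r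
    bound = weak-duality (adj G) P Q P-support Q-support (List.lookup L)
      (λ i → approx (weight (List.lookup L i)) K ℚ.+ (ε ℚ.+ ε)) (ι 3 ℚ.* ε) (ι 3 ℚ.* ε ℚ.+ ι (3 * l) ℚ.* ε)
      (λ i → Q≤P _ (copy i))
      -- At precision `K`, the definition of `_≤ᴿ_` says precisely that the approximation shifted by
      -- `2ε` is nonnegative.
      (λ i → nonNeg _ (copy i) K)
      (λ x y xy → lower x y (proj₂ (covers x y xy) K))
      (λ x y xy → upper x y (proj₁ (covers x y xy) K))
      where
      mass : ∀ x y → ℚ
      mass x y = approx (sumᴿ (List.map weight (filter (contains? x y) L))) K
      cover : ∀ x y → ℚ
      cover = coverage (List.lookup L) (λ i → approx (weight (List.lookup L i)) K ℚ.+ (ε ℚ.+ ε))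
      thrice : ∀ c e → (c ℚ.+ e) ℚ.+ (e ℚ.+ e) ≡ c ℚ.+ ι 3 ℚ.* e
      thrice = solve 2 (λ c e → (c :+ e) :+ (e :+ e) := c :+ con (ι 3) :* e) refl
      thrice′ : ∀ e k → ((1ℚ ℚ.+ (e ℚ.+ e)) ℚ.+ e) ℚ.+ k ≡ 1ℚ ℚ.+ (ι 3 ℚ.* e ℚ.+ k)
      thrice′ = solve 2 (λ e k → ((con 1ℚ :+ (e :+ e)) :+ e) :+ k := con 1ℚ :+ (con (ι 3) :* e :+ k)) refl
      lower : ∀ x y → 1ℚ ℚ.≤ mass x y ℚ.+ (ε ℚ.+ ε) → 1ℚ ℚ.≤ cover x y ℚ.+ ι 3 ℚ.* ε
      lower x y 1≤mass = begin
        1ℚ                                  ≤⟨ 1≤mass ⟩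
        mass x y ℚ.+ (ε ℚ.+ ε)              ≤⟨ ℚ.+-monoˡ-≤ (ε ℚ.+ ε) (approx-covered≤ x y weight K L K) ⟩
        (cover x y ℚ.+ ε) ℚ.+ (ε ℚ.+ ε)     ≡⟨ thrice (cover x y) ε ⟩
        cover x y ℚ.+ ι 3 ℚ.* ε             ∎
      upper : ∀ x y → mass x y ℚ.≤ 1ℚ ℚ.+ (ε ℚ.+ ε) →
        cover x y ℚ.≤ 1ℚ ℚ.+ (ι 3 ℚ.* ε ℚ.+ ι (3 * l) ℚ.* ε)
      upper x y mass≤1 = begin
        cover x y                                         ≤⟨ ≤approx-covered x y weight K L K ⟩
        (mass x y ℚ.+ ε) ℚ.+ ι (3 * l) ℚ.* ε
          ≤⟨ ℚ.+-monoˡ-≤ (ι (3 * l) ℚ.* ε) (ℚ.+-monoˡ-≤ ε mass≤1) ⟩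
        ((1ℚ ℚ.+ (ε ℚ.+ ε)) ℚ.+ ε) ℚ.+ ι (3 * l) ℚ.* ε    ≡⟨ thrice′ ε (ι (3 * l) ℚ.* ε) ⟩
        1ℚ ℚ.+ (ι 3 ℚ.* ε ℚ.+ ι (3 * l) ℚ.* ε)            ∎

-- Edge counts, divisibility and minimum degree of regular graphs.

length-filter-tabulate : ∀ {A : Set} {P : Pred A 0ℓ} (P? : Decidable P) {n} (f : Fin n → A) →
  length (filter P? (List.tabulate f)) ≡ sum (λ x → ind (does (P? (f x))))
length-filter-tabulate P? {zero}  f = refl
length-filter-tabulate P? {suc n} f with does (P? (f zero))
... | false = length-filter-tabulate P? (f ∘ suc)
... | true  = cong suc (length-filter-tabulate P? (f ∘ suc))

length-filter-cartesianProduct : ∀ {A B : Set} {P : Pred (A × B) 0ℓ} (P? : Decidable P)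
  {m n} (f : Fin m → A) (g : Fin n → B) →
  length (filter P? (cartesianProduct (List.tabulate f) (List.tabulate g)))
    ≡ total (λ x y → ind (does (P? (f x , g y))))
length-filter-cartesianProduct P? {zero}  f g = refl
length-filter-cartesianProduct P? {suc m} f g = begin
  length (filter P? (List.map (f zero ,_) (List.tabulate g) List.++ rest))
    ≡⟨ cong length (List.filter-++ P? (List.map (f zero ,_) (List.tabulate g)) rest) ⟩
  length (filter P? (List.map (f zero ,_) (List.tabulate g)) List.++ filter P? rest)
    ≡⟨ List.length-++ (filter P? (List.map (f zero ,_) (List.tabulate g))) ⟩
  length (filter P? (List.map (f zero ,_) (List.tabulate g))) + length (filter P? rest)
    ≡⟨ cong₂ _+_
         (trans (cong (length ∘ filter P?) (List.map-tabulate g (f zero ,_))) (length-filter-tabulate P? λ y → f zero , g y))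
         (length-filter-cartesianProduct P? (f ∘ suc) g) ⟩
  total (λ x y → ind (does (P? (f x , g y)))) ∎
  where
  open ≡-Reasoning
  rest = cartesianProduct (List.tabulate (f ∘ suc)) (List.tabulate g)

total-cong : ∀ {m n} {V W : Fin m → Fin n → ℕ} → (∀ x y → V x y ≡ W x y) → total V ≡ total W
total-cong V≡W = sum-cong-≗ λ x → sum-cong-≗ (V≡W x)

total-mono : ∀ {m n} {V W : Fin m → Fin n → ℕ} → (∀ x y → V x y ≤ W x y) → total V ≤ total W
total-mono V≤W = sum-mono λ x → sum-mono (V≤W x)

total-+ : ∀ {m n} (V W : Fin m → Fin n → ℕ) →
  total (λ x y → V x y + W x y) ≡ total V + total W
total-+ V W = trans (sum-cong-≗ λ x → ∑-distrib-+ (V x) (W x))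
  (∑-distrib-+ (λ x → sum (V x)) (λ x → sum (W x)))

total-* : ∀ {m n} (f : Fin m → ℕ) (g : Fin n → ℕ) → total (λ x y → f x * g y) ≡ sum f * sum g
total-* f g = trans (sum-cong-≗ λ x → sym (*-distribˡ-sum (f x) g)) (sym (*-distribʳ-sum (sum g) f))

degree≡sum : ∀ G x → degree G x ≡ sum (λ y → ind (adj G x y))
degree≡sum G x = trans (∣S∣≡sum (Vec.tabulate (adj G x)))
  (sum-cong-≗ λ y → cong ind (lookup∘tabulate (adj G x) y))

-- `edges` lists each edge once, with the smaller end first. Transposing the count supplies the
-- pairs in the other order.
handshake : ∀ G → e G + e G ≡ sum (degree G)
handshake G = begin
  e G + e G                          ≡⟨ cong₂ _+_ e≡ e≡ ⟩
  total up + total up                ≡⟨ cong (_+_ (total up)) (∑-comm up) ⟩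
  total up + total (λ x y → up y x)  ≡⟨ total-+ up (λ x y → up y x) ⟨
  total (λ x y → up x y + up y x)    ≡⟨ total-cong up+down ⟩
  total (λ x y → ind (adj G x y))    ≡⟨ sum-cong-≗ (λ x → sym (degree≡sum G x)) ⟩
  sum (degree G)                     ∎
  where
  open ≡-Reasoning
  up : Fin (v G) → Fin (v G) → ℕ
  up x y = ind (does (x Fin.<? y)) * ind (adj G x y)
  e≡ : e G ≡ total up
  e≡ = trans (length-filter-cartesianProduct (λ (x , y) → (x Fin.<? y) ×-dec T? (adj G x y)) id id)
    (total-cong λ x y → ind-∧ (does (x Fin.<? y)) (adj G x y))
  up+down : ∀ x y → up x y + up y x ≡ ind (adj G x y)
  up+down x y rewrite symm G y x with Fin.<-cmp x y
  ... | tri< x<y _ y≮x rewrite dec-true (x Fin.<? y) x<y | dec-false (y Fin.<? x) y≮x =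
    trans (ℕ.+-identityʳ _) (ℕ.*-identityˡ _)
  ... | tri≈ _ refl _  rewrite irrefl G x | ℕ.*-zeroʳ (ind (does (x Fin.<? x))) = refl
  ... | tri> x≮y _ y<x rewrite dec-false (x Fin.<? y) x≮y | dec-true (y Fin.<? x) y<x =
    ℕ.*-identityˡ _

nC2*2≡n*[n∸1] : ∀ n → (n C 2) * 2 ≡ n * (n ∸ 1)
nC2*2≡n*[n∸1] zero    = refl
nC2*2≡n*[n∸1] (suc n) = begin
  (suc n C 2) * 2            ≡⟨ cong (_* 2) (nCk+nC[k+1]≡[n+1]C[k+1] n 1) ⟨
  ((n C 1) + (n C 2)) * 2       ≡⟨ cong (λ z → (z + (n C 2)) * 2) (nC1≡n n) ⟩
  (n + (n C 2)) * 2           ≡⟨ ℕ.*-distribʳ-+ 2 n (n C 2) ⟩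
  n * 2 + (n C 2) * 2         ≡⟨ cong (_+_ (n * 2)) (nC2*2≡n*[n∸1] n) ⟩
  n * 2 + n * (n ∸ 1)        ≡⟨ step n ⟩
  suc n * n                  ∎
  where
  open ≡-Reasoning
  open ℕ-Solver
  step : ∀ n → n * 2 + n * (n ∸ 1) ≡ suc n * n
  step zero    = refl
  step (suc n) = solve 1 (λ n → (con 1 :+ n) :* con 2 :+ (con 1 :+ n) :* n
                              := (con 2 :+ n) :* (con 1 :+ n)) refl n

-- One divisibility serves both conditions: `q ∸ 1` divides `d`, and for `d = k * q * (q - 1)` the
-- handshake identity gives `e G = v G * k * (q C 2)` after cancelling 2.
regular⇒Divisible : ∀ q G d → q * (q ∸ 1) ∣ d → (∀ x → degree G x ≡ d) → Divisible q G
regular⇒Divisible q G d (divides k d≡) deg =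
  divides (v G * k) (ℕ.*-cancelʳ-≡ (e G) _ 2 e*2) ,
  λ x → divides (k * q) (trans (deg x) (trans d≡ (sym (ℕ.*-assoc k q (q ∸ 1)))))
  where
  open ≡-Reasoning
  e*2 : e G * 2 ≡ (v G * k) * (q C 2) * 2
  e*2 = begin
    e G * 2                       ≡⟨ trans (ℕ.*-comm (e G) 2) (cong (_+_ (e G)) (ℕ.+-identityʳ (e G))) ⟩
    e G + e G                     ≡⟨ handshake G ⟩
    sum (degree G)                ≡⟨ sum-cong-≗ deg ⟩
    sum {v G} (λ _ → d)           ≡⟨ sum-const (v G) d ⟩
    v G * d                       ≡⟨ cong (v G *_) d≡ ⟩
    v G * (k * (q * (q ∸ 1)))     ≡⟨ cong (λ z → v G * (k * z)) (nC2*2≡n*[n∸1] q) ⟨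
    v G * (k * ((q C 2) * 2))       ≡⟨ ℕ.*-assoc (v G) k _ ⟨
    (v G * k) * ((q C 2) * 2)       ≡⟨ ℕ.*-assoc (v G * k) (q C 2) 2 ⟨
    (v G * k) * (q C 2) * 2       ∎

regular⇒≤δ : ∀ G d → d ≤ v G → (∀ x → degree G x ≡ d) → d ≤ δ G
regular⇒≤δ G d d≤v deg = go (allFin (v G))
  where
  go : ∀ xs → d ≤ foldr ℕ._⊓_ (v G) (List.map (degree G) xs)
  -- The fold defining `δ` starts from `v G`.
  go []       = d≤v
  go (x ∷ xs) = ℕ.⊓-glb (ℕ.≤-reflexive (sym (deg x))) (go xs)

-- The quadratic inequality behind the nonnegative weight of cliques.

m≤m*m : ∀ m → m ≤ m * m
m≤m*m zero    = z≤n
m≤m*m (suc m) = ℕ.m≤m*n (suc m) (suc m)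

private
  -- Twice the inequality on clique weights, with all negative terms moved to the left. Writing the
  -- larger of two counts as `a + k` avoids subtraction; symmetry in `a` and `b` then gives
  -- `quadratic-bound`.
  quadratic-ordered : ∀ a k c → 4 ≤ a + (a + k) + c →
    (a * (a + k) + (a + k) * a) + (2 * a + 2 * (a + k) + c) ≤ a * (2 * a) + (a + k) * (2 * (a + k)) + c * c
  quadratic-ordered zero k c _ = begin
    k * 0 + (2 * k + c)   ≡⟨ cong (_+ (2 * k + c)) (ℕ.*-zeroʳ k) ⟩
    2 * k + c             ≤⟨ ℕ.+-mono-≤ (ℕ.*-monoʳ-≤ 2 (m≤m*m k)) (m≤m*m c) ⟩
    2 * (k * k) + c * c   ≡⟨ cong (_+ c * c) (solve 1 (λ k → con 2 :* (k :* k) := k :* (con 2 :* k)) refl k) ⟩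
    k * (2 * k) + c * c   ∎
    where
    open ℕ.≤-Reasoning
    open ℕ-Solver
  -- The critical case `a = b = 1`: at least four vertices force two in the third part, and equality
  -- holds when there are exactly two.
  quadratic-ordered 1 zero (suc (suc c)) _ = begin
    8 + c                             ≤⟨ ℕ.m≤m+n (8 + c) (c * c + 3 * c) ⟩
    8 + c + (c * c + 3 * c)           ≡⟨ solve 1 (λ c → con 8 :+ c :+ (c :* c :+ con 3 :* c)
                                           := con 4 :+ (con 2 :+ c) :* (con 2 :+ c)) refl c ⟩
    4 + (2 + c) * (2 + c)             ∎
    where
    open ℕ.≤-Reasoning
    open ℕ-Solver
  quadratic-ordered 1 zero zero          (s≤s (s≤s ()))
  quadratic-ordered 1 zero (suc zero)    (s≤s (s≤s (s≤s ())))
  quadratic-ordered 1 k@(suc _) c _ = begin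
    (1 * (1 + k) + (1 + k) * 1) + (2 * 1 + 2 * (1 + k) + c)
      ≡⟨ solve 2 (λ k c → (con 1 :* (con 1 :+ k) :+ (con 1 :+ k) :* con 1) :+ (con 2 :* con 1 :+ con 2 :* (con 1 :+ k) :+ c)
           := con 4 :+ con 4 :* k :+ (con 2 :* con 1 :+ c)) refl k c ⟩
    4 + 4 * k + (2 * 1 + c)
      ≤⟨ ℕ.+-monoʳ-≤ (4 + 4 * k) (ℕ.+-mono-≤ (ℕ.*-monoʳ-≤ 2 (s≤s z≤n)) (m≤m*m c)) ⟩
    4 + 4 * k + (2 * (k * k) + c * c)
      ≡⟨ solve 2 (λ k c → con 4 :+ con 4 :* k :+ (con 2 :* (k :* k) :+ c :* c)
           := con 1 :* (con 2 :* con 1) :+ (con 1 :+ k) :* (con 2 :* (con 1 :+ k)) :+ c :* c) refl k c ⟩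
    1 * (2 * 1) + (1 + k) * (2 * (1 + k)) + c * c ∎
    where
    open ℕ.≤-Reasoning
    open ℕ-Solver
  quadratic-ordered (suc (suc a)) k c _ = begin
    ((2 + a) * (2 + a + k) + (2 + a + k) * (2 + a)) + (2 * (2 + a) + 2 * (2 + a + k) + c)
      -- With `A = 2 + a` the added slack is `2 * A * (A - 2) + 2 * A * k`; what then remains is to
      -- replace `k` and `c` by their squares.
      ≤⟨ ℕ.m≤m+n _ (4 * a + 2 * a * a + 2 * (2 + a) * k) ⟩
    ((2 + a) * (2 + a + k) + (2 + a + k) * (2 + a)) + (2 * (2 + a) + 2 * (2 + a + k) + c)
      + (4 * a + 2 * a * a + 2 * (2 + a) * k)
      ≡⟨ solve 3 (λ a k c →
           ((con 2 :+ a) :* (con 2 :+ a :+ k) :+ (con 2 :+ a :+ k) :* (con 2 :+ a))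
             :+ (con 2 :* (con 2 :+ a) :+ con 2 :* (con 2 :+ a :+ k) :+ c)
             :+ (con 4 :* a :+ con 2 :* a :* a :+ con 2 :* (con 2 :+ a) :* k)
           := (con 4 :* (con 2 :+ a) :* (con 2 :+ a) :+ con 4 :* (con 2 :+ a) :* k) :+ (con 2 :* k :+ c)) refl a k c ⟩
    (4 * (2 + a) * (2 + a) + 4 * (2 + a) * k) + (2 * k + c)
      ≤⟨ ℕ.+-monoʳ-≤ (4 * (2 + a) * (2 + a) + 4 * (2 + a) * k)
           (ℕ.+-mono-≤ (ℕ.*-monoʳ-≤ 2 (m≤m*m k)) (m≤m*m c)) ⟩
    (4 * (2 + a) * (2 + a) + 4 * (2 + a) * k) + (2 * (k * k) + c * c)
      ≡⟨ solve 3 (λ a k c →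
           (con 4 :* (con 2 :+ a) :* (con 2 :+ a) :+ con 4 :* (con 2 :+ a) :* k) :+ (con 2 :* (k :* k) :+ c :* c)
           := (con 2 :+ a) :* (con 2 :* (con 2 :+ a)) :+ (con 2 :+ a :+ k) :* (con 2 :* (con 2 :+ a :+ k)) :+ c :* c)
           refl a k c ⟩
    (2 + a) * (2 * (2 + a)) + (2 + a + k) * (2 * (2 + a + k)) + c * c ∎
    where
    open ℕ.≤-Reasoning
    open ℕ-Solver

quadratic-bound : ∀ a b c → 4 ≤ a + b + c →
  (a * b + b * a) + (2 * a + 2 * b + c) ≤ a * (2 * a) + b * (2 * b) + c * c
quadratic-bound a b c 4≤ with ℕ.≤-total a b
... | inj₁ a≤b = subst (λ z → (a * z + z * a) + (2 * a + 2 * z + c) ≤ a * (2 * a) + z * (2 * z) + c * c)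
  (ℕ.m+[n∸m]≡n a≤b) (quadratic-ordered a (b ∸ a) c
    (subst (λ z → 4 ≤ a + z + c) (sym (ℕ.m+[n∸m]≡n a≤b)) 4≤))
... | inj₂ b≤a = begin
  (a * b + b * a) + (2 * a + 2 * b + c)
    ≡⟨ cong₂ _+_ (ℕ.+-comm (a * b) (b * a)) (cong (_+ c) (ℕ.+-comm (2 * a) (2 * b))) ⟩
  (b * a + a * b) + (2 * b + 2 * a + c)
    ≤⟨ subst (λ z → (b * z + z * b) + (2 * b + 2 * z + c) ≤ b * (2 * b) + z * (2 * z) + c * c)
         (ℕ.m+[n∸m]≡n b≤a) (quadratic-ordered b (a ∸ b) c
           (subst (λ z → 4 ≤ b + z + c) (sym (ℕ.m+[n∸m]≡n b≤a))
             (subst (λ z → 4 ≤ z + c) (ℕ.+-comm a b) 4≤))) ⟩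
  b * (2 * b) + a * (2 * a) + c * c
    ≡⟨ cong (_+ c * c) (ℕ.+-comm (b * (2 * b)) (a * (2 * a))) ⟩
  a * (2 * a) + b * (2 * b) + c * c ∎
  where open ℕ.≤-Reasoning


-- The constant and the minimum degree bound over the reals.

-- Addition of reals shifts the index, which has no effect on constant sequences.
approx-· : ∀ k {x p} → (∀ n → approx x n ≡ p) → ∀ n → approx (k · x) n ≡ ι k ℚ.* p
approx-· zero    {p = p} x≡p n = sym (ℚ.*-zeroˡ p)
approx-· (suc k) {x} {p} x≡p n = begin
  approx x (suc n) ℚ.+ approx (k · x) (suc n)  ≡⟨ cong₂ ℚ._+_ (x≡p (suc n)) (approx-· k x≡p (suc n)) ⟩
  p ℚ.+ ι k ℚ.* p                              ≡⟨ cong (ℚ._+ ι k ℚ.* p) (ℚ.*-identityˡ p) ⟨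
  1ℚ ℚ.* p ℚ.+ ι k ℚ.* p                       ≡⟨ ℚ.*-distribʳ-+ p 1ℚ (ι k) ⟨
  (1ℚ ℚ.+ ι k) ℚ.* p                           ≡⟨ cong (ℚ._* p) (ι-+ 1 k) ⟨
  ι (suc k) ℚ.* p                              ∎
  where open ≡-Reasoning

recipℚ-inverse : ∀ p → 1ℚ ℚ.≤ p → p ℚ.* recipℚ p ≡ 1ℚ
recipℚ-inverse p 1≤p = trans (cong (ℚ._* recipℚ p) (sym (ℚ.p≤q⇒p⊔q≡q 1≤p))) (recipℚ-inv p)

ι-pos : ∀ n .{{_ : ℕ.NonZero n}} → ℚ.Positive (ι n)
ι-pos (suc n) = ℚ.normalize-pos (suc n) 1

module _ (n : ℕ) .{{_ : ℕ.NonZero n}} where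

  private
    instance
      ι-nonZero : ℚ.NonZero (ι n)
      ι-nonZero = ℚ.pos⇒nonZero (ι n) {{ι-pos n}}

  -- The constant `c` of the theorem, for `n = D * (q + 1)`.
  [1+n]/n : ℚ
  [1+n]/n = ι (suc n) ℚ.* 1/ ι n

  n*[1+n]/n : ι n ℚ.* [1+n]/n ≡ ι (suc n)
  n*[1+n]/n = begin
    ι n ℚ.* (ι (suc n) ℚ.* 1/ ι n)     ≡⟨ solve 3 (λ a b c → a :* (b :* c) := (a :* c) :* b) refl (ι n) (ι (suc n)) (1/ ι n) ⟩
    (ι n ℚ.* 1/ ι n) ℚ.* ι (suc n)     ≡⟨ cong (ℚ._* ι (suc n)) (ℚ.*-inverseʳ (ι n)) ⟩
    1ℚ ℚ.* ι (suc n)                   ≡⟨ ℚ.*-identityˡ (ι (suc n)) ⟩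
    ι (suc n)                          ∎
    where
    open ≡-Reasoning
    open ℚ-Solver

  1<[1+n]/n : 1ᴿ <ᴿ fromℚ [1+n]/n
  -- At index `suc n` the required slack is `2^- n`, which is less than `1 / n` because
  -- `(n + 1) * 2^- n ≤ 1`.
  1<[1+n]/n = suc n , ℚ.*-cancelˡ-<-nonNeg (ι n) {{ℚ.pos⇒nonNeg (ι n) {{ι-pos n}}}} (begin-strict
    ι n ℚ.* (1ℚ ℚ.+ (½ ℚ.* ε ℚ.+ ½ ℚ.* ε))
      ≡⟨ solve 2 (λ s e → s :* (con 1ℚ :+ (con ½ :* e :+ con ½ :* e)) := (s :+ s :* e) :+ con 0ℚ) refl (ι n) ε ⟩
    (ι n ℚ.+ ι n ℚ.* ε) ℚ.+ 0ℚ
      <⟨ ℚ.+-monoʳ-< (ι n ℚ.+ ι n ℚ.* ε) (2^->0 n) ⟩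
    (ι n ℚ.+ ι n ℚ.* ε) ℚ.+ ε
      ≡⟨ solve 2 (λ s e → (s :+ s :* e) :+ e := s :+ (con 1ℚ :+ s) :* e) refl (ι n) ε ⟩
    ι n ℚ.+ (1ℚ ℚ.+ ι n) ℚ.* ε
      ≡⟨ cong (λ z → ι n ℚ.+ z ℚ.* ε) (ι-+ 1 n) ⟨
    ι n ℚ.+ ι (suc n) ℚ.* ε
      ≤⟨ ℚ.+-monoʳ-≤ (ι n) (suc-n*2^-n≤1 n) ⟩
    ι n ℚ.+ 1ℚ
      ≡⟨ ℚ.+-comm (ι n) 1ℚ ⟩
    1ℚ ℚ.+ ι n
      ≡⟨ trans (sym (ι-+ 1 n)) (sym n*[1+n]/n) ⟩
    ι n ℚ.* [1+n]/n ∎)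
    where
    open ℚ.≤-Reasoning
    open ℚ-Solver
    ε = 2^- n

-- Here `k * c = (1 + D * k) / D`, so dividing `n` by it gives exactly `N * D`, the number of
-- vertices missed by a vertex of degree `d`. The right-hand real is thus the constant sequence `d`.
minDegree-bound : ∀ k D .{{_ : ℕ.NonZero k}} .{{_ : ℕ.NonZero D}} c →
  ι (D * k) ℚ.* c ≡ ι (suc (D * k)) →
  ∀ N n d δ → n ≡ N * suc (D * k) → n ≡ d + N * D → d ≤ δ →
  fromℕ δ ≥ᴿ n · (1ᴿ -ᴿ recip (k · fromℚ c))
minDegree-bound k D c Dkc≡1+Dk N n d δ n≡N*[1+Dk] n≡d+ND d≤δ i = begin
  approx (n · (1ᴿ -ᴿ recip (k · fromℚ c))) i
    ≡⟨ approx-· n (λ j → cong (λ z → 1ℚ ℚ.+ (ℚ.- recipℚ z)) (approx-· k (λ _ → refl) (suc j))) i ⟩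
  ι n ℚ.* (1ℚ ℚ.+ (ℚ.- recipℚ X))
    ≡⟨ solve 2 (λ n r → n :* (con 1ℚ :+ (:- r)) := n :+ (:- (n :* r))) refl (ι n) (recipℚ X) ⟩
  ι n ℚ.+ (ℚ.- (ι n ℚ.* recipℚ X))
    ≡⟨ cong₂ (λ y z → y ℚ.+ (ℚ.- z)) (trans (cong ι n≡d+ND) (ι-+ d (N * D))) n*recip ⟩
  (ι d ℚ.+ ι (N * D)) ℚ.+ (ℚ.- ι (N * D))
    ≡⟨ solve 2 (λ d e → (d :+ e) :+ (:- e) := d) refl (ι d) (ι (N * D)) ⟩
  ι d
    ≤⟨ ι-mono d≤δ ⟩
  ι δ
    ≤⟨ p≤p+2^-sum (ι δ) i i ⟩
  ι δ ℚ.+ (2^- i ℚ.+ 2^- i) ∎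
  where
  open ℚ.≤-Reasoning
  open ℚ-Solver
  X = ι k ℚ.* c
  D*X : ι D ℚ.* X ≡ ι (suc (D * k))
  D*X = begin-equality
    ι D ℚ.* (ι k ℚ.* c)    ≡⟨ ℚ.*-assoc (ι D) (ι k) c ⟨
    (ι D ℚ.* ι k) ℚ.* c    ≡⟨ cong (ℚ._* c) (ι-* D k) ⟨
    ι (D * k) ℚ.* c        ≡⟨ Dkc≡1+Dk ⟩
    ι (suc (D * k))                    ∎
  -- This makes the truncated `recipℚ X` the true reciprocal.
  1≤X : 1ℚ ℚ.≤ X
  1≤X = ℚ.*-cancelˡ-≤-pos (ι D) {{ι-pos D}} (begin
    ι D ℚ.* 1ℚ         ≡⟨ ℚ.*-identityʳ (ι D) ⟩
    ι D                ≤⟨ ι-mono (ℕ.m≤n⇒m≤1+n (ℕ.m≤m*n D k)) ⟩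
    ι (suc (D * k))    ≡⟨ D*X ⟨
    ι D ℚ.* X          ∎)
  n*recip : ι n ℚ.* recipℚ X ≡ ι (N * D)
  n*recip = begin-equality
    ι n ℚ.* recipℚ X                       ≡⟨ cong (ℚ._* recipℚ X) (trans (cong ι n≡N*[1+Dk]) (ι-* N (suc (D * k)))) ⟩
    (ι N ℚ.* ι (suc (D * k))) ℚ.* recipℚ X ≡⟨ cong (λ z → (ι N ℚ.* z) ℚ.* recipℚ X) D*X ⟨
    (ι N ℚ.* (ι D ℚ.* X)) ℚ.* recipℚ X     ≡⟨ solve 4 (λ a b c d → (a :* (b :* c)) :* d := (a :* b) :* (c :* d)) refl (ι N) (ι D) X (recipℚ X) ⟩
    (ι N ℚ.* ι D) ℚ.* (X ℚ.* recipℚ X)     ≡⟨ cong₂ ℚ._*_ (sym (ι-* N D)) (recipℚ-inverse X 1≤X) ⟩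
    ι (N * D) ℚ.* 1ℚ                       ≡⟨ ℚ.*-identityʳ (ι (N * D)) ⟩
    ι (N * D)                              ∎

-- Parts of the base graph and dual weights.

-- The index of the part containing a vertex; nothing for the vertices of the
-- independent sets.
Place : Set
Place = Maybe (Fin 3)

inPart : Fin 3 → Place → ℕ
inPart i (just j) = ind (does (j Fin.≟ i))
inPart i nothing  = 0

independent : Place → ℕ
independent (just _) = 0
independent nothing  = 1

-- The positive and the negative part of the dual weights. All totals run over
-- ordered pairs of vertices, so every edge counts twice.
reward penalty : Place → Place → ℕ
reward  k l = inPart 0F k * (2 * inPart 0F l) + inPart 1F k * (2 * inPart 1F l) + inPart 2F k * inPart 2F l
penalty k l = inPart 0F k * inPart 1F l + inPart 1F k * inPart 0F l

-- What the reward would give to a pair of equal vertices.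
loop : Place → ℕ
loop k = 2 * inPart 0F k + 2 * inPart 1F k + inPart 2F k

part-partition : ∀ k → inPart 0F k + inPart 1F k + inPart 2F k + independent k ≡ 1
part-partition (just 0F) = refl
part-partition (just 1F) = refl
part-partition (just 2F) = refl
part-partition nothing   = refl

reward-diagonal : ∀ k → reward k k ≡ loop k
reward-diagonal (just 0F) = refl
reward-diagonal (just 1F) = refl
reward-diagonal (just 2F) = refl
reward-diagonal nothing   = refl

reward-nothing : ∀ k → reward k nothing ≡ 0
reward-nothing (just 0F) = refl
reward-nothing (just 1F) = refl
reward-nothing (just 2F) = refl
reward-nothing nothing   = refl

penalty-diagonal : ∀ k → penalty k k ≡ 0
penalty-diagonal (just 0F) = refl
penalty-diagonal (just 1F) = refl
penalty-diagonal (just 2F) = refl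
penalty-diagonal nothing   = refl

penalty-nothing : ∀ k → penalty k nothing ≡ 0
penalty-nothing (just 0F) = refl
penalty-nothing (just 1F) = refl
penalty-nothing (just 2F) = refl
penalty-nothing nothing   = refl

-- The blow-up.

-- The base graph adj₀ has m vertices, each replaced by N independent ones;
-- to it r independent sets of D * N vertices are joined completely.
module BlowUp {m d D : ℕ} .{{_ : ℕ.NonZero D}}
  (adj₀ : Fin m → Fin m → Bool) (part : Fin m → Fin 3)
  (adj₀-symm : ∀ a b → adj₀ a b ≡ adj₀ b a)
  (adj₀-irrefl : ∀ a → adj₀ a a ≡ false)
  (adj₀-cross : ∀ a b → adj₀ a b ≡ false → part a ≡ part b)
  (adj₀-degree : ∀ a → sum (λ b → ind (adj₀ a b)) ≡ d)
  (d+D≡m : d + D ≡ m) (m≡1+D*5 : m ≡ suc (D * 5))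
  (gap : total (λ a b → ind (adj₀ a b) * reward (just (part a)) (just (part b)))
       < total (λ a b → penalty (just (part a)) (just (part b))))
  where

  module _ (q r N : ℕ) (4+r≡q : 4 + r ≡ q) where

    Kind : Set
    Kind = Fin m ⊎ Fin r

    adjᴷ : Kind → Kind → Bool
    adjᴷ (inj₁ a) (inj₁ b) = adj₀ a b
    adjᴷ (inj₁ _) (inj₂ _) = true
    adjᴷ (inj₂ _) (inj₁ _) = true
    adjᴷ (inj₂ i) (inj₂ j) = not (does (i Fin.≟ j))

    adjᴷ-symm : ∀ k l → adjᴷ k l ≡ adjᴷ l k
    adjᴷ-symm (inj₁ a) (inj₁ b) = adj₀-symm a b
    adjᴷ-symm (inj₁ _) (inj₂ _) = refl
    adjᴷ-symm (inj₂ _) (inj₁ _) = refl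
    adjᴷ-symm (inj₂ i) (inj₂ j) with i Fin.≟ j
    ... | yes refl = cong not (sym (dec-true (i Fin.≟ i) refl))
    ... | no  i≢j  = cong not (sym (dec-false (j Fin.≟ i) (i≢j ∘ sym)))

    adjᴷ-irrefl : ∀ k → adjᴷ k k ≡ false
    adjᴷ-irrefl (inj₁ a) = adj₀-irrefl a
    adjᴷ-irrefl (inj₂ i) = cong not (dec-true (i Fin.≟ i) refl)

    placeᴷ : Kind → Place
    placeᴷ (inj₁ a) = just (part a)
    placeᴷ (inj₂ _) = nothing

    P₀ Q₀ : Kind → Kind → ℕ
    P₀ k l = ind (adjᴷ k l) * reward (placeᴷ k) (placeᴷ l)
    Q₀ k l = penalty (placeᴷ k) (placeᴷ l)

    -- A penalised pair lies in two different parts, and `adj₀-cross` makes such pairs adjacent.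
    Q₀-support : ∀ k l → adjᴷ k l ≡ false → Q₀ k l ≡ 0
    Q₀-support (inj₁ a) (inj₁ b) eq = trans (cong (λ p → penalty (just (part a)) (just p)) (sym (adj₀-cross a b eq)))
      (penalty-diagonal (just (part a)))
    Q₀-support (inj₁ _) (inj₂ _) ()
    Q₀-support (inj₂ _) l        _ = refl

    order : ℕ
    order = m * N + r * (D * N)

    kind : Fin order → Kind
    kind x = Sum.map (quotient N) (quotient (D * N)) (splitAt (m * N) x)

    graph : Graph
    graph = record
      { v      = order
      ; adj    = λ x y → adjᴷ (kind x) (kind y)
      ; symm   = λ x y → adjᴷ-symm (kind x) (kind y)
      ; irrefl = λ x → adjᴷ-irrefl (kind x)
      }

    sum-kind : ∀ f → sum (f ∘ kind) ≡ N * sum (f ∘ inj₁) + D * N * sum (f ∘ inj₂)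
    sum-kind f = trans (sum-splitAt (m * N) (f ∘ Sum.map (quotient N) (quotient (D * N))))
      (cong₂ _+_ (sum-quotient N (f ∘ inj₁)) (sum-quotient (D * N) (f ∘ inj₂)))

    order≡ : order ≡ N * (d + D * r) + N * D
    order≡ = trans (cong (λ z → z * N + r * (D * N)) (sym d+D≡m))
      (solve 4 (λ d D r N → (d :+ D) :* N :+ r :* (D :* N) := N :* (d :+ D :* r) :+ N :* D) refl d D r N)
      where open ℕ-Solver

    -- A copy of a base vertex misses the `N` copies of `m - d = D` base vertices; a vertex of an
    -- independent set misses its own set of `D * N`. The sizes are chosen so that these agree.
    degree≡ : ∀ x → degree graph x ≡ N * (d + D * r)
    degree≡ x = trans (degree≡sum graph x)
      (trans (sum-kind (ind ∘ adjᴷ (kind x))) (by-kind (kind x)))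
      where
      open ℕ-Solver
      others : ∀ {n} (i : Fin n) → 1 + sum (λ j → ind (not (does (i Fin.≟ j)))) ≡ n
      others {suc n} zero    = cong suc (trans (sum-const n 1) (ℕ.*-identityʳ n))
      others {suc n} (suc i) = cong suc (others i)
      by-kind : ∀ k → N * sum (λ b → ind (adjᴷ k (inj₁ b))) + D * N * sum (λ j → ind (adjᴷ k (inj₂ j)))
                    ≡ N * (d + D * r)
      by-kind (inj₁ a) = trans (cong₂ (λ s t → N * s + D * N * t) (adj₀-degree a) (sum-const r 1))
        (solve 4 (λ d D N r → N :* d :+ D :* N :* (r :* con 1) := N :* (d :+ D :* r)) refl d D N r)
      by-kind (inj₂ i) = begin
        N * sum {m} (λ _ → 1) + D * N * s
          ≡⟨ cong (λ z → N * z + D * N * s) (trans (sum-const m 1) (trans (ℕ.*-identityʳ m) (sym d+D≡m))) ⟩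
        N * (d + D) + D * N * s
          ≡⟨ solve 4 (λ d D N s → N :* (d :+ D) :+ D :* N :* s := N :* (d :+ D :* (con 1 :+ s))) refl d D N s ⟩
        N * (d + D * (1 + s))
          ≡⟨ cong (λ z → N * (d + D * z)) (others i) ⟩
        N * (d + D * r) ∎
        where
        open ≡-Reasoning
        s = sum (λ j → ind (not (does (i Fin.≟ j))))

    place : Fin order → Place
    place = placeᴷ ∘ kind

    P Q : Fin order → Fin order → ℕ
    P x y = P₀ (kind x) (kind y)
    Q x y = Q₀ (kind x) (kind y)

    P-support : ∀ x y → adj graph x y ≡ false → P x y ≡ 0
    P-support x y eq rewrite eq = refl

    Q-support : ∀ x y → adj graph x y ≡ false → Q x y ≡ 0
    Q-support x y = Q₀-support (kind x) (kind y)

    -- Only pairs of base kinds contribute, and each of them comes from `N * N` pairs of vertices,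
    -- so the gap of the base graph scales by the square of `N`.
    total-kind : ∀ (f : Kind → Kind → ℕ) → (∀ a j → f (inj₁ a) (inj₂ j) ≡ 0) → (∀ i l → f (inj₂ i) l ≡ 0) →
      total (λ x y → f (kind x) (kind y)) ≡ N * (N * total (λ a b → f (inj₁ a) (inj₁ b)))
    total-kind f right left = begin
      sum (λ x → sum (λ y → f (kind x) (kind y)))
        ≡⟨ sum-cong-≗ (λ x → sum-kind (f (kind x))) ⟩
      sum (λ x → row (kind x))
        ≡⟨ sum-kind row ⟩
      N * sum (λ a → row (inj₁ a)) + D * N * sum (λ i → row (inj₂ i))
        ≡⟨ cong₂ (λ s t → N * s + D * N * t) (trans (sum-cong-≗ row₁) (sym (*-distribˡ-sum N λ a → sum (λ b → f (inj₁ a) (inj₁ b)))))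
             (sum≡0 row₂) ⟩
      N * (N * total (λ a b → f (inj₁ a) (inj₁ b))) + D * N * 0
        ≡⟨ trans (cong (_+_ (N * (N * total (λ a b → f (inj₁ a) (inj₁ b))))) (ℕ.*-zeroʳ (D * N))) (ℕ.+-identityʳ _) ⟩
      N * (N * total (λ a b → f (inj₁ a) (inj₁ b))) ∎
      where
      open ≡-Reasoning
      row : Kind → ℕ
      row k = N * sum (λ b → f k (inj₁ b)) + D * N * sum (λ j → f k (inj₂ j))
      sum≡0 : ∀ {n} {g : Fin n → ℕ} → (∀ x → g x ≡ 0) → sum g ≡ 0
      sum≡0 {n} g≡0 = trans (sum-cong-≗ g≡0) (sum-replicate-zero n)
      row₁ : ∀ a → row (inj₁ a) ≡ N * sum (λ b → f (inj₁ a) (inj₁ b))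
      row₁ a rewrite sum≡0 (right a) | ℕ.*-zeroʳ (D * N) = ℕ.+-identityʳ _
      row₂ : ∀ i → row (inj₂ i) ≡ 0
      row₂ i rewrite sum≡0 (λ b → left i (inj₁ b)) | sum≡0 (λ j → left i (inj₂ j))
                   | ℕ.*-zeroʳ N | ℕ.*-zeroʳ (D * N) = refl

    P<Q : 0 < N → total P < total Q
    P<Q 0<N = begin-strict
      total P
        ≡⟨ total-kind P₀ (λ a j → cong (1 *_) (reward-nothing (just (part a)))) (λ i l → ℕ.*-zeroʳ (ind (adjᴷ (inj₂ i) l))) ⟩
      N * (N * total (λ a b → ind (adj₀ a b) * reward (just (part a)) (just (part b))))
        <⟨ ℕ.*-monoʳ-< N {{ℕ.>-nonZero 0<N}} (ℕ.*-monoʳ-< N {{ℕ.>-nonZero 0<N}} gap) ⟩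
      N * (N * total (λ a b → penalty (just (part a)) (just (part b))))
        ≡⟨ total-kind Q₀ (λ a j → penalty-nothing (just (part a))) (λ i l → refl) ⟨
      total Q ∎
      where open ℕ.≤-Reasoning

    -- The weight of a clique.

    module _ (S : Subset order) (copy : IsCopy q graph S) where

      private
        clique-adj : ∀ x y → T (Vec.lookup S x) → T (Vec.lookup S y) → x ≢ y → adjᴷ (kind x) (kind y) ≡ true
        clique-adj x y x∈S y∈S x≢y = T⇒≡true (proj₂ copy x y
          (lookup⇒[]= x S (T⇒≡true x∈S)) (lookup⇒[]= y S (T⇒≡true y∈S)) x≢y)
          where
          T⇒≡true : ∀ {b} → T b → b ≡ true
          T⇒≡true {true} _ = refl

        count : (Place → ℕ) → ℕ
        count f = sum λ x → χ S x * f (place x)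

        s₀ = count (inPart 0F)
        s₁ = count (inPart 1F)
        s₂ = count (inPart 2F)

        isIndependent : Kind → Fin r → Bool
        isIndependent (inj₁ _) j = false
        isIndependent (inj₂ i) j = does (i Fin.≟ j)

        independent≡ : ∀ k → independent (placeᴷ k) ≡ sum (λ j → ind (isIndependent k j))
        independent≡ (inj₁ a) = sym (sum-replicate-zero r)
        independent≡ (inj₂ i) = sym (trans (sum-cong-≗ λ j → sym (ℕ.*-identityʳ (ind (does (i Fin.≟ j))))) (sum-at i (λ _ → 1)))

        at-most-one : ∀ j x y → T (Vec.lookup S x ∧ isIndependent (kind x) j) →
          T (Vec.lookup S y ∧ isIndependent (kind y) j) → x ≡ y
        at-most-one j x y p q with x Fin.≟ y
        ... | yes x≡y = x≡y
        -- Abstracting `clique-adj x y` too specialises its type along with the kinds. Only two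
        -- vertices of the same independent set survive, and these would have to be adjacent.
        ... | no  x≢y with kind x | kind y | Vec.lookup S x in x∈S | Vec.lookup S y in y∈S
                         | clique-adj x y
        ... | inj₂ i | inj₂ i′ | true | true | adjacent with i Fin.≟ j | i′ Fin.≟ j
        ... | yes refl | yes refl with () ← trans (sym (cong not (dec-true (i Fin.≟ i) refl))) (adjacent _ _ x≢y)

        independent≤r : count independent ≤ r
        independent≤r = begin
          sum (λ x → χ S x * independent (place x))
            ≡⟨ sum-cong-≗ (λ x → trans (cong (χ S x *_) (independent≡ (kind x)))
                 (*-distribˡ-sum (χ S x) λ j → ind (isIndependent (kind x) j))) ⟩
          sum (λ x → sum λ j → χ S x * ind (isIndependent (kind x) j))
            ≡⟨ ∑-comm (λ x j → χ S x * ind (isIndependent (kind x) j)) ⟩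
          sum (λ j → sum λ x → χ S x * ind (isIndependent (kind x) j))
            ≡⟨ sum-cong-≗ (λ j → sum-cong-≗ λ x → sym (ind-∧ (Vec.lookup S x) (isIndependent (kind x) j))) ⟩
          sum (λ j → sum λ x → ind (Vec.lookup S x ∧ isIndependent (kind x) j))
            ≤⟨ sum-mono (λ j → sum-ind≤1 (λ x → Vec.lookup S x ∧ isIndependent (kind x) j) (at-most-one j)) ⟩
          sum {r} (λ _ → 1)
            ≡⟨ trans (sum-const r 1) (ℕ.*-identityʳ r) ⟩
          r ∎
          where open ℕ.≤-Reasoning

        count-+ : ∀ f g → count (λ k → f k + g k) ≡ count f + count g
        count-+ f g = trans (sum-cong-≗ λ x → ℕ.*-distribˡ-+ (χ S x) (f (place x)) (g (place x)))
          (∑-distrib-+ (λ x → χ S x * f (place x)) (λ x → χ S x * g (place x)))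

        count-2* : ∀ f → count (λ k → 2 * f k) ≡ 2 * count f
        count-2* f = trans (sum-cong-≗ λ x → solve 2 (λ s f → s :* (con 2 :* f) := con 2 :* (s :* f)) refl (χ S x) (f (place x)))
          (sym (*-distribˡ-sum 2 λ x → χ S x * f (place x)))
          where open ℕ-Solver

        -- Each of the `q - 4` independent sets contains at most one of the `q` vertices of the
        -- clique.
        4≤s : 4 ≤ s₀ + s₁ + s₂
        4≤s = ℕ.+-cancelʳ-≤ r 4 _ (begin
          4 + r                                  ≡⟨ trans 4+r≡q (trans (sym (proj₁ copy)) (∣S∣≡sum S)) ⟩
          sum (χ S)                              ≡⟨ sum-cong-≗ (λ x → trans (sym (ℕ.*-identityʳ (χ S x)))
                                                      (cong (χ S x *_) (sym (part-partition (place x))))) ⟩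
          count (λ k → inPart 0F k + inPart 1F k + inPart 2F k + independent k)
            ≡⟨ trans (count-+ (λ k → inPart 0F k + inPart 1F k + inPart 2F k) independent)
                 (cong (_+ count independent) (trans (count-+ (λ k → inPart 0F k + inPart 1F k) (inPart 2F))
                   (cong (_+ s₂) (count-+ (inPart 0F) (inPart 1F))))) ⟩
          s₀ + s₁ + s₂ + count independent       ≤⟨ ℕ.+-monoʳ-≤ (s₀ + s₁ + s₂) independent≤r ⟩
          s₀ + s₁ + s₂ + r                       ∎)
          where open ℕ.≤-Reasoning

        within-* : ∀ f g → within S (λ x y → f (place x) * g (place y)) ≡ count f * count g
        within-* f g = trans (total-cong λ x y → solve 4 (λ s t f g → s :* t :* (f :* g) := (s :* f) :* (t :* g)) refl
            (χ S x) (χ S y) (f (place x)) (g (place y)))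
          (total-* (λ x → χ S x * f (place x)) (λ y → χ S y * g (place y)))
          where open ℕ-Solver

        within-+ : ∀ V W → within S (λ x y → V x y + W x y) ≡ within S V + within S W
        within-+ V W = trans (total-cong λ x y → ℕ.*-distribˡ-+ (χ S x * χ S y) (V x y) (W x y))
          (total-+ (λ x y → χ S x * χ S y * V x y) (λ x y → χ S x * χ S y * W x y))

        within-Q : within S Q ≡ s₀ * s₁ + s₁ * s₀
        within-Q = trans (within-+ (λ x y → inPart 0F (place x) * inPart 1F (place y)) (λ x y → inPart 1F (place x) * inPart 0F (place y)))
          (cong₂ _+_ (within-* (inPart 0F) (inPart 1F)) (within-* (inPart 1F) (inPart 0F)))

        within-reward : within S (λ x y → reward (place x) (place y)) ≡ s₀ * (2 * s₀) + s₁ * (2 * s₁) + s₂ * s₂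
        within-reward = trans
          (trans (within-+ (λ x y → inPart 0F (place x) * (2 * inPart 0F (place y)) + inPart 1F (place x) * (2 * inPart 1F (place y)))
                           (λ x y → inPart 2F (place x) * inPart 2F (place y)))
            (cong₂ _+_ (within-+ (λ x y → inPart 0F (place x) * (2 * inPart 0F (place y))) (λ x y → inPart 1F (place x) * (2 * inPart 1F (place y))))
                       (within-* (inPart 2F) (inPart 2F))))
          (cong (_+ s₂ * s₂) (cong₂ _+_ (doubled (inPart 0F)) (doubled (inPart 1F))))
          where
          doubled : ∀ f → within S (λ x y → f (place x) * (2 * f (place y))) ≡ count f * (2 * count f)
          doubled f = trans (within-* f (λ k → 2 * f k)) (cong (count f *_) (count-2* f))

        count-loop : count loop ≡ 2 * s₀ + 2 * s₁ + s₂
        count-loop = trans (count-+ (λ k → 2 * inPart 0F k + 2 * inPart 1F k) (inPart 2F)) (cong (_+ s₂)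
          (trans (count-+ (λ k → 2 * inPart 0F k) (λ k → 2 * inPart 1F k)) (cong₂ _+_ (count-2* (inPart 0F)) (count-2* (inPart 1F)))))

        -- Distinct vertices of the clique are adjacent, so there `P` is the full reward. On the
        -- diagonal `P` vanishes and `loop` makes up for it. The full reward is preferable because
        -- its sum over the clique factors into the counts `s₀`, `s₁`, `s₂`.
        reward≤ : ∀ x y → χ S x * χ S y * reward (place x) (place y)
          ≤ χ S x * χ S y * P x y + ind (does (x Fin.≟ y)) * (χ S x * loop (place x))
        reward≤ x y with x Fin.≟ y
        ... | yes refl rewrite adjᴷ-irrefl (kind x) | reward-diagonal (place x) with Vec.lookup S x
        ...   | false = z≤n
        ...   | true  = ℕ.≤-reflexive (sym (ℕ.+-identityʳ _))
        reward≤ x y | no x≢y with Vec.lookup S x | Vec.lookup S y | clique-adj x y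
        ...   | false | _     | _        = z≤n
        ...   | true  | false | _        = z≤n
        ...   | true  | true  | adjacent rewrite adjacent _ _ x≢y =
          ℕ.≤-reflexive (solve 1 (λ w → con 1 :* con 1 :* w := con 1 :* con 1 :* (con 1 :* w) :+ con 0) refl (reward (place x) (place y)))
          where open ℕ-Solver

        within-reward≤ : within S (λ x y → reward (place x) (place y)) ≤ within S P + count loop
        within-reward≤ = begin
          total (λ x y → χ S x * χ S y * reward (place x) (place y))
            ≤⟨ total-mono reward≤ ⟩
          total (λ x y → χ S x * χ S y * P x y + ind (does (x Fin.≟ y)) * (χ S x * loop (place x)))
            ≡⟨ total-+ (λ x y → χ S x * χ S y * P x y) (λ x y → ind (does (x Fin.≟ y)) * (χ S x * loop (place x))) ⟩
          within S P + total (λ x y → ind (does (x Fin.≟ y)) * (χ S x * loop (place x)))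
            ≡⟨ cong (_+_ (within S P)) (sum-cong-≗ λ x → sum-at x (λ _ → χ S x * loop (place x))) ⟩
          within S P + count loop ∎
          where open ℕ.≤-Reasoning

      -- Adding the diagonal term to both sides turns the claim into `quadratic-bound` for the
      -- numbers of clique vertices in the three parts.
      Q≤P : within S Q ≤ within S P
      Q≤P = ℕ.+-cancelʳ-≤ (2 * s₀ + 2 * s₁ + s₂) _ _ (begin
        within S Q + (2 * s₀ + 2 * s₁ + s₂)                    ≡⟨ cong (_+ (2 * s₀ + 2 * s₁ + s₂)) within-Q ⟩
        s₀ * s₁ + s₁ * s₀ + (2 * s₀ + 2 * s₁ + s₂)             ≤⟨ quadratic-bound s₀ s₁ s₂ 4≤s ⟩
        s₀ * (2 * s₀) + s₁ * (2 * s₁) + s₂ * s₂                ≡⟨ within-reward ⟨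
        within S (λ x y → reward (place x) (place y))            ≤⟨ within-reward≤ ⟩
        within S P + count loop                                ≡⟨ cong (_+_ (within S P)) count-loop ⟩
        within S P + (2 * s₀ + 2 * s₁ + s₂)                    ∎)
        where open ℕ.≤-Reasoning

    -- The base graph is one vertex larger than five independent sets of size `D`; this surplus is
    -- what puts the constant above 1.
    order-scaled : order ≡ N * suc (D * suc q)
    order-scaled = begin
      m * N + r * (D * N)                ≡⟨ cong (λ z → z * N + r * (D * N)) m≡1+D*5 ⟩
      suc (D * 5) * N + r * (D * N)      ≡⟨ solve 3 (λ D r N → (con 1 :+ D :* con 5) :* N :+ r :* (D :* N)
                                              := N :* (con 1 :+ D :* (con 5 :+ r))) refl D r N ⟩
      N * suc (D * (5 + r))              ≡⟨ cong (λ z → N * suc (D * suc z)) 4+r≡q ⟩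
      N * suc (D * suc q)                ∎
      where
      open ≡-Reasoning
      open ℕ-Solver

    minDegree : ∀ c → ι (D * suc q) ℚ.* c ≡ ι (suc (D * suc q)) →
      fromℕ (δ graph) ≥ᴿ v graph · (1ᴿ -ᴿ recip (suc q · fromℚ c))
    minDegree c c≡ = minDegree-bound (suc q) D c c≡ N (v graph) (N * (d + D * r)) (δ graph) order-scaled order≡
      (regular⇒≤δ graph (N * (d + D * r)) (subst (N * (d + D * r) ≤_) (sym order≡) (ℕ.m≤m+n _ (N * D))) degree≡)

    divisible : q * (q ∸ 1) ∣ N → Divisible q graph
    divisible q[q-1]∣N = regular⇒Divisible q graph (N * (d + D * r)) (∣m⇒∣m*n (d + D * r) q[q-1]∣N) degree≡

    no-decomposition : 0 < N → ¬ Decomposition q graph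
    no-decomposition 0<N = ¬decomposition graph P Q P-support Q-support Q≤P (P<Q 0<N)

    no-fractionalDecomposition : 0 < N → ¬ FractionalDecomposition q graph
    no-fractionalDecomposition 0<N = ¬fractionalDecomposition graph P Q P-support Q-support Q≤P (P<Q 0<N)

  -- The infinite family.

  counterexamples : ∀ q → q ≥ 4 → Σ ℝ λ c → (c >ᴿ 1ᴿ) × InfinitelyMany (λ G →
    Divisible q G
    × (fromℕ (δ G) ≥ᴿ v G · (1ᴿ -ᴿ recip (suc q · c)))
    × (¬ Decomposition q G)
    × (¬ FractionalDecomposition q G))
  counterexamples q q≥4 = fromℚ c , 1<[1+n]/n (D * suc q) , G ,
    (λ i → divisible q r (N i) 4+r≡q (divides (suc i) refl) , minDegree q r (N i) 4+r≡q c (n*[1+n]/n (D * suc q))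
         , no-decomposition q r (N i) 4+r≡q (0<N i) , no-fractionalDecomposition q r (N i) 4+r≡q (0<N i)) ,
    -- Isomorphic graphs have the same order, and the order `N i * suc (D * suc q)` determines `i`.
    λ i j i≢j G≅H → i≢j (ℕ.suc-injective (ℕ.*-cancelʳ-≡ (suc i) (suc j) M
      (ℕ.*-cancelʳ-≡ (N i) (N j) (suc (D * suc q))
        (trans (sym (order-scaled q r (N i) 4+r≡q)) (trans (↔⇒≡ (_≅_.bijection G≅H)) (order-scaled q r (N j) 4+r≡q))))))
    where
    r = q ∸ 4
    4+r≡q = ℕ.m+[n∸m]≡n q≥4
    M = q * (q ∸ 1)
    0<M : 0 < M
    0<M = ℕ.*-mono-≤ {1} {q} {1} (ℕ.≤-trans (s≤s z≤n) q≥4) (ℕ.≤-trans (s≤s z≤n) (ℕ.∸-monoˡ-≤ 1 q≥4))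
    N : ℕ → ℕ
    -- A positive multiple of `q * (q ∸ 1)`, which makes the common degree divisible by it.
    N i = suc i * M
    0<N : ∀ i → 0 < N i
    0<N i = ℕ.≤-trans 0<M (ℕ.m≤m+n M (i * M))
    G : ℕ → Graph
    G i = graph q r (N i) 4+r≡q
    instance
      M-nonZero : ℕ.NonZero M
      M-nonZero = ℕ.>-nonZero 0<M
      D*suc-nonZero : ℕ.NonZero (D * suc q)
      D*suc-nonZero = ℕ.m*n≢0 D (suc q)
    c : ℚ
    c = [1+n]/n (D * suc q)

-- The base graph on 66 vertices.

-- The vertices 0–23, 24–47 and 48–65 form the three parts, divided into blocks
-- of 12, 12 and 6 consecutive vertices, which are the cliques.
basePart : Fin 66 → Fin 3
basePart a = if toℕ a <ᵇ 24 then 0F else if toℕ a <ᵇ 48 then 1F else 2F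

clique : Fin 66 → ℕ
clique a = if toℕ a <ᵇ 48 then toℕ a / 12 else toℕ a / 6

baseAdj : Fin 66 → Fin 66 → Bool
baseAdj a b = not (does (basePart a Fin.≟ basePart b)) ∨ ((clique a ≡ᵇ clique b) ∧ not (does (a Fin.≟ b)))

abstract
  baseAdj-symm : ∀ a b → baseAdj a b ≡ baseAdj b a
  baseAdj-symm = from-yes (Fin.all? λ a → Fin.all? λ b → baseAdj a b Bool.≟ baseAdj b a)

  baseAdj-irrefl : ∀ a → baseAdj a a ≡ false
  baseAdj-irrefl = from-yes (Fin.all? λ a → baseAdj a a Bool.≟ false)

  baseAdj-cross : ∀ a b → baseAdj a b ≡ false → basePart a ≡ basePart b
  baseAdj-cross a b eq with basePart a Fin.≟ basePart b
  ... | yes same = same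

  -- The count is 11 + 24 + 18 in the first two parts and 5 + 48 in the third.
  baseAdj-degree : ∀ a → sum (λ b → ind (baseAdj a b)) ≡ 53
  baseAdj-degree = from-yes (Fin.all? λ a → sum (λ b → ind (baseAdj a b)) ℕ.≟ 53)

  -- Evaluates to 1146 < 1152.
  base-gap : total (λ a b → ind (baseAdj a b) * reward (just (basePart a)) (just (basePart b)))
           < total (λ a b → penalty (just (basePart a)) (just (basePart b)))
  base-gap = ℕ.<ᵇ⇒< _ _ _

theorem1p3 : ∀ (q : ℕ) → q ≥ 4 →
    Σ ℝ λ c → (c >ᴿ 1ᴿ) × InfinitelyMany (λ G →
    Divisible q G
    × (fromℕ (δ G) ≥ᴿ v G · (1ᴿ -ᴿ recip (suc q · c)))
    × (¬ Decomposition q G)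
    × (¬ FractionalDecomposition q G))
theorem1p3 =
  -- The two equations proved by `refl` are `53 + 13 = 66` and `66 = 1 + 13 * 5`.
  BlowUp.counterexamples {D = 13} baseAdj basePart baseAdj-symm baseAdj-irrefl baseAdj-cross
    baseAdj-degree refl refl base-gap
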